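{- Let $\lambda,y\in\mathbb C$ with $\lambda>0$, and let $C\neq 0$. Define polynomials $\{P_n^{\lambda,C,y}(x)\}_{n\ge 0}$ by $$\sum_{n\ge 0}P_n^{\lambda,C,y}(x)\,t^n=(C-2xt+yt^2)^{ -\lambda}.$$ The coefficient matrix $A=(a_{n,k})_{n,k\ge 0}$ defined by $P_n^{\lambda,C,y}(x)=\sum_{k=0}^n a_{n,k}x^k$ has entries $$a_{n,k}=\begin{cases}\dfrac{(\lambda)_{\frac{n+k}{2}}\,2^k\,(-y)^{\frac{n-k}{2}}}{k!\,\bigl(\frac{n-k}{2}\bigr)!\,C^{\lambda+\frac{n+k}{2}}}&\text{if }n-k\ge 0\text{ and even},\\[2mm] 0&\text{otherwise}.\end{cases}$$ The inverse matrix $A^{ -1}=(b_{n,k})_{n,k\ge 0}$ exists, such that $x^n=\sum_{k=0}^n b_{n,k}P_k^{\lambda,C,y}(x)$, with entries $$b_{n,k}=\begin{cases}\dfrac{n!\,(\lambda+k)\,y^{\frac{n-k}{2}}\,C^{\lambda+\frac{n+k}{2}}}{2^n\,\bigl(\frac{n-k}{2}\bigr)!\,(\lambda)_{\frac{n+k}{2}+1}}&\text{if }n-k\ge 0\text{ and even},\\[2mm] 0&\text{otherwise}.\end{cases}$$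
   Context: $(\lambda)_r=\lambda(\lambda+1)\cdots(\lambda+r-1)$, $(\lambda)_0=1$, is the rising factorial. The condition $\lambda>0$ means that $\lambda$ is a positive real number. The power $(C-2xt+yt^2)^{ -\lambda}$ is the formal power series in $t$ given by $C^{ -\lambda}\bigl(1-\frac{2x}{C}t+\frac{y}{C}t^2\bigr)^{ -\lambda}$ expanded by the binomial series, with a fixed choice of the value $C^{\lambda}$ and $C^{\lambda+m}=C^\lambda C^m$ for integers $m$, $C^{ -\lambda}=1/C^\lambda$. -}

module Defs where

open import Level using (0ℓ)
open import Algebra.Bundles using (CommutativeRing)
open import Algebra.Solver.Ring.AlmostCommutativeRing
  using (fromCommutativeRing; _-Raw-AlmostCommutative⟶_)
open import Algebra.Structures using (IsCommutativeRing)
open import Data.Empty using (⊥-elim)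
import Data.Integer.Base as ℤ
open import Data.List.Base using (List; []; _∷_; map)
open import Data.Maybe.Base as Maybe using (Maybe)
open import Data.Nat.Base as ℕ using (ℕ; zero; suc; _!)
import Data.Nat.DivMod as ℕ
import Data.Nat.Divisibility as ℕ
import Data.Nat.Properties as ℕ
open import Data.Product.Base using (Σ; ∃-syntax; _×_; _,_; proj₁; proj₂)
open import Data.Rational.Base as ℚ using (ℚ; 0ℚ; 1ℚ; ½; ∣_∣)
import Data.Rational.Properties as ℚ
import Data.Rational.Solver as ℚ
open import Data.Sum.Base using (inj₁; inj₂)
open import Relation.Binary.PropositionalEquality
  using (_≡_; _≢_; refl; sym; trans; cong; cong₂; subst; subst₂)
open import Relation.Binary.Structures using (IsEquivalence)
open import Relation.Nullary.Decidable.Core using (yes; no; dec⇒maybe)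

private
  module ℚS = ℚ.+-*-Solver

private

  half-pos : ∀ {ε} → 0ℚ ℚ.< ε → 0ℚ ℚ.< ½ ℚ.* ε
  half-pos {ε} 0<ε = ℚ.positive⁻¹ (½ ℚ.* ε) {{ℚ.pos*pos⇒pos ½ ε {{ℚ.positive 0<ε}}}}

  halves : ∀ ε → ½ ℚ.* ε ℚ.+ ½ ℚ.* ε ≡ ε
  halves ε = trans (sym (ℚ.*-distribʳ-+ ε ½ ½)) (ℚ.*-identityˡ ε)

  pos-*ℚ : ∀ {p q} → 0ℚ ℚ.< p → 0ℚ ℚ.< q → 0ℚ ℚ.< p ℚ.* q
  pos-*ℚ {p} {q} 0<p 0<q = ℚ.positive⁻¹ (p ℚ.* q)
    {{ℚ.pos*pos⇒pos p {{ℚ.positive 0<p}} q {{ℚ.positive 0<q}}}}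

  abs-pos : ∀ {p} → 0ℚ ℚ.< p → ∣ p ∣ ≡ p
  abs-pos 0<p = ℚ.0≤p⇒∣p∣≡p (ℚ.<⇒≤ 0<p)

  p≤∣p∣ : ∀ p → p ℚ.≤ ∣ p ∣
  p≤∣p∣ p with ℚ.≤-total 0ℚ p
  ... | inj₁ 0≤p = ℚ.≤-reflexive (sym (ℚ.0≤p⇒∣p∣≡p 0≤p))
  ... | inj₂ p≤0 = ℚ.≤-trans p≤0 (ℚ.0≤∣p∣ p)

private

  +-cancelʳ-<ℚ : ∀ {p q} r → p ℚ.+ r ℚ.< q ℚ.+ r → p ℚ.< q
  +-cancelʳ-<ℚ {p} {q} r lt =
    subst₂ ℚ._<_ (undo p r) (undo q r) (ℚ.+-monoˡ-< (ℚ.- r) lt)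
    where
    undo : ∀ a b → (a ℚ.+ b) ℚ.- b ≡ a
    undo = ℚS.solve 2 (λ a b → (a ℚS.:+ b) ℚS.:- b ℚS.:= a) refl

-- The total reciprocal, with inv 0 = 0.
inv : ℚ → ℚ
inv q with q ℚ.≟ 0ℚ
... | yes _  = 0ℚ
... | no q≢0 = ℚ.1/_ q {{ℚ.≢-nonZero q≢0}}

private

  *-inv : ∀ {q} → 0ℚ ℚ.< q → q ℚ.* inv q ≡ 1ℚ
  *-inv {q} 0<q with q ℚ.≟ 0ℚ
  ... | yes q≡0 = ⊥-elim (ℚ.<⇒≢ 0<q (sym q≡0))
  ... | no q≢0  = ℚ.*-inverseʳ q {{ℚ.≢-nonZero q≢0}}

  inv-pos : ∀ {q} → 0ℚ ℚ.< q → 0ℚ ℚ.< inv q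
  inv-pos {q} 0<q = ℚ.*-cancelˡ-<-nonNeg q {{ℚ.pos⇒nonNeg q {{ℚ.positive 0<q}}}}
    (subst (ℚ._< q ℚ.* inv q) (sym (ℚ.*-zeroʳ q))
      (subst (0ℚ ℚ.<_) (sym (*-inv 0<q)) (ℚ.positive⁻¹ 1ℚ)))

  inv-anti : ∀ {p q} → 0ℚ ℚ.< p → p ℚ.< q → inv q ℚ.≤ inv p
  inv-anti {p} {q} 0<p p<q = ℚ.*-cancelˡ-≤-pos p {{ℚ.positive 0<p}} (begin
    p ℚ.* inv q   ≤⟨ ℚ.*-monoʳ-≤-nonNeg (inv q) {{ℚ.nonNegative (ℚ.<⇒≤ (inv-pos 0<q))}} (ℚ.<⇒≤ p<q) ⟩
    q ℚ.* inv q   ≡⟨ *-inv 0<q ⟩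
    1ℚ            ≡⟨ *-inv 0<p ⟨
    p ℚ.* inv p   ∎)
    where
    open ℚ.≤-Reasoning
    0<q = ℚ.<-trans 0<p p<q

-- Functions that become small, or stay bounded, along a decreasing family
-- T 0 ⊇ T 1 ⊇ … of subsets of A.
private
 module Along {A : Set} (T : ℕ → A → Set)
              (anti : ∀ {M N a} → M ℕ.≤ N → T N a → T M a) where

  Eventually : (A → Set) → Set
  Eventually Q = ∃[ N ] (∀ a → T N a → Q a)

  record Small (f : A → ℚ) : Set where
    constructor mkSmall
    field small : ∀ ε → 0ℚ ℚ.< ε → Eventually (λ a → ∣ f a ∣ ℚ.< ε)

  open Small public

  record Bounded (f : A → ℚ) : Set where
    constructor mkBounded
    field
      bound   : ℚ
      0<bound : 0ℚ ℚ.< bound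
      bounded : Eventually (λ a → ∣ f a ∣ ℚ.< bound)

  infixr 4 _&_
  _&_ : ∀ {Q R} → Eventually Q → Eventually R → Eventually (λ a → Q a × R a)
  (M , q) & (N , r) = M ℕ.⊔ N , λ a t →
    q a (anti (ℕ.m≤m⊔n M N) t) , r a (anti (ℕ.m≤n⊔m M N) t)

  mapE : ∀ {Q R : A → Set} → (∀ a → Q a → R a) → Eventually Q → Eventually R
  mapE h (N , q) = N , λ a t → h a (q a t)

  small-cong : ∀ {f g} → Eventually (λ a → f a ≡ g a) → Small f → Small g
  small (small-cong eq f-small) ε 0<ε =
    mapE (λ { a (e , h) → subst (λ q → ∣ q ∣ ℚ.< ε) e h }) (eq & small f-small ε 0<ε)

  small-cong′ : ∀ {f g} → (∀ a → f a ≡ g a) → Small f → Small g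
  small-cong′ eq = small-cong (0 , λ a _ → eq a)

  small-0 : ∀ {f} → (∀ a → f a ≡ 0ℚ) → Small f
  small (small-0 eq) ε 0<ε = 0 , λ a _ → subst (λ q → ∣ q ∣ ℚ.< ε) (sym (eq a)) 0<ε

  small-neg : ∀ {f} → Small f → Small (λ a → ℚ.- f a)
  small (small-neg {f} f-small) ε 0<ε =
    mapE (λ a → subst (ℚ._< ε) (sym (ℚ.∣-p∣≡∣p∣ (f a)))) (small f-small ε 0<ε)

  small-+ : ∀ {f g} → Small f → Small g → Small (λ a → f a ℚ.+ g a)
  small (small-+ {f} {g} f-small g-small) ε 0<ε =
    mapE (λ { a (p , q) → ℚ.≤-<-trans (ℚ.∣p+q∣≤∣p∣+∣q∣ (f a) (g a))
                            (subst (∣ f a ∣ ℚ.+ ∣ g a ∣ ℚ.<_) (halves ε) (ℚ.+-mono-< p q)) })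
      (small f-small (½ ℚ.* ε) (half-pos 0<ε) & small g-small (½ ℚ.* ε) (half-pos 0<ε))

  small-* : ∀ {f g} → Bounded f → Small g → Small (λ a → f a ℚ.* g a)
  small (small-* {f} {g} (mkBounded B 0<B f<B) g-small) ε 0<ε =
    mapE (λ { a (p , q) → begin-strict
      ∣ f a ℚ.* g a ∣         ≡⟨ ℚ.∣p*q∣≡∣p∣*∣q∣ (f a) (g a) ⟩
      ∣ f a ∣ ℚ.* ∣ g a ∣     ≤⟨ ℚ.*-monoʳ-≤-nonNeg ∣ g a ∣ {{ℚ.∣-∣-nonNeg (g a)}} (ℚ.<⇒≤ p) ⟩
      B ℚ.* ∣ g a ∣           <⟨ ℚ.*-monoʳ-<-pos B {{ℚ.positive 0<B}} q ⟩
      B ℚ.* (inv B ℚ.* ε)     ≡⟨ ℚ.*-assoc B (inv B) ε ⟨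
      (B ℚ.* inv B) ℚ.* ε     ≡⟨ cong (ℚ._* ε) (*-inv 0<B) ⟩
      1ℚ ℚ.* ε                ≡⟨ ℚ.*-identityˡ ε ⟩
      ε                       ∎ })
      (f<B & small g-small (inv B ℚ.* ε) (pos-*ℚ (inv-pos 0<B) 0<ε))
    where open ℚ.≤-Reasoning

  bounded-* : ∀ {f g} → Bounded f → Bounded g → Bounded (λ a → f a ℚ.* g a)
  bounded-* {f} {g} (mkBounded B 0<B f<B) (mkBounded C 0<C g<C) = mkBounded (B ℚ.* C) (pos-*ℚ 0<B 0<C)
    (mapE (λ { a (p , q) → begin-strict
      ∣ f a ℚ.* g a ∣         ≡⟨ ℚ.∣p*q∣≡∣p∣*∣q∣ (f a) (g a) ⟩
      ∣ f a ∣ ℚ.* ∣ g a ∣     ≤⟨ ℚ.*-monoʳ-≤-nonNeg ∣ g a ∣ {{ℚ.∣-∣-nonNeg (g a)}} (ℚ.<⇒≤ p) ⟩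
      B ℚ.* ∣ g a ∣           <⟨ ℚ.*-monoʳ-<-pos B {{ℚ.positive 0<B}} q ⟩
      B ℚ.* C                 ∎ })
      (f<B & g<C))
    where open ℚ.≤-Reasoning

record IsCauchy (s : ℕ → ℚ) : Set where
  constructor mkCauchy
  field
    close : ∀ ε → 0ℚ ℚ.< ε →
      ∃[ N ] (∀ m n → N ℕ.≤ m → N ℕ.≤ n → ∣ s m ℚ.- s n ∣ ℚ.< ε)

open IsCauchy public

-- Classically this is the field of real numbers, with _≈ʳ_ as equality.
record ℝ : Set where
  no-eta-equality
  constructor real
  field
    seq    : ℕ → ℚ
    cauchy : IsCauchy seq

open ℝ public

infix 4 _≈ʳ_ _<ʳ_

record _≈ʳ_ (x y : ℝ) : Set where
  constructor mk≈ʳ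
  field
    null : ∀ ε → 0ℚ ℚ.< ε →
      ∃[ N ] (∀ n → N ℕ.≤ n → ∣ seq x n ℚ.- seq y n ∣ ℚ.< ε)

open _≈ʳ_ public

record Positiveʳ (x : ℝ) : Set where
  constructor mkPos
  field
    bound    : ℚ
    0<bound  : 0ℚ ℚ.< bound
    index    : ℕ
    bounded  : ∀ n → index ℕ.≤ n → bound ℚ.< seq x n

private

  module T₁ = Along ℕ._≤_ ℕ.≤-trans

  Both≥ : ℕ → ℕ × ℕ → Set
  Both≥ N a = N ℕ.≤ proj₁ a × N ℕ.≤ proj₂ a

  Both≥-anti : ∀ {M N a} → M ℕ.≤ N → Both≥ N a → Both≥ M a
  Both≥-anti M≤N (p , q) = ℕ.≤-trans M≤N p , ℕ.≤-trans M≤N q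

  module T₂ = Along Both≥ Both≥-anti

  gap : (ℕ → ℚ) → ℕ × ℕ → ℚ
  gap s (m , n) = s m ℚ.- s n

  cauchy→small : ∀ {s} → IsCauchy s → T₂.Small (gap s)
  T₂.Small.small (cauchy→small c) ε 0<ε =
    let (N , h) = close c ε 0<ε in N , λ { (m , n) (p , q) → h m n p q }

  small→cauchy : ∀ {s} → T₂.Small (gap s) → IsCauchy s
  close (small→cauchy c) ε 0<ε =
    let (N , h) = T₂.small c ε 0<ε in N , λ m n p q → h (m , n) (p , q)

  bounded₁ : ∀ {s} → IsCauchy s → T₁.Bounded s
  bounded₁ {s} c = let (N , h) = close c 1ℚ (ℚ.positive⁻¹ 1ℚ) in
    T₁.mkBounded (1ℚ ℚ.+ ∣ s N ∣)
    (ℚ.<-≤-trans (ℚ.positive⁻¹ 1ℚ)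
      (ℚ.≤-trans (ℚ.≤-reflexive (sym (ℚ.+-identityʳ 1ℚ))) (ℚ.+-monoʳ-≤ 1ℚ (ℚ.0≤∣p∣ (s N)))))
    (N , λ n N≤n → begin-strict
      ∣ s n ∣                          ≡⟨ cong ∣_∣ (split (s n) (s N)) ⟩
      ∣ (s n ℚ.- s N) ℚ.+ s N ∣        ≤⟨ ℚ.∣p+q∣≤∣p∣+∣q∣ (s n ℚ.- s N) (s N) ⟩
      ∣ s n ℚ.- s N ∣ ℚ.+ ∣ s N ∣      <⟨ ℚ.+-monoˡ-< ∣ s N ∣ (h n N N≤n ℕ.≤-refl) ⟩
      1ℚ ℚ.+ ∣ s N ∣                   ∎)
    where
    open ℚ.≤-Reasoning
    split : ∀ p q → p ≡ (p ℚ.- q) ℚ.+ q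
    split = ℚS.solve 2 (λ p q → p ℚS.:= (p ℚS.:- q) ℚS.:+ q) refl

  fst-bounded : ∀ {s} → T₁.Bounded s → T₂.Bounded (λ a → s (proj₁ a))
  fst-bounded (T₁.mkBounded B 0<B (N , h)) = T₂.mkBounded B 0<B (N , λ { (m , n) (p , _) → h m p })

  snd-bounded : ∀ {s} → T₁.Bounded s → T₂.Bounded (λ a → s (proj₂ a))
  snd-bounded (T₁.mkBounded B 0<B (N , h)) = T₂.mkBounded B 0<B (N , λ { (m , n) (_ , q) → h n q })

  gap₁ : ℝ → ℝ → ℕ → ℚ
  gap₁ x y n = seq x n ℚ.- seq y n

  ≈→small : ∀ {x y} → x ≈ʳ y → T₁.Small (gap₁ x y)
  ≈→small e = T₁.mkSmall (null e)

  small→≈ : ∀ {x y} → T₁.Small (gap₁ x y) → x ≈ʳ y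
  small→≈ e = mk≈ʳ (T₁.small e)

  seq≡⇒≈ʳ : ∀ {x y} → (∀ n → seq x n ≡ seq y n) → x ≈ʳ y
  seq≡⇒≈ʳ {x} {y} eq = small→≈ (T₁.small-0 λ n →
    trans (cong (ℚ._- seq y n) (eq n)) (ℚ.+-inverseʳ (seq y n)))

infixl 6 _+ʳ_ _-ʳ_
infixl 7 _*ʳ_
infix  8 -ʳ_

_+ʳ_ : ℝ → ℝ → ℝ
seq    (x +ʳ y) n = seq x n ℚ.+ seq y n
cauchy (x +ʳ y) = small→cauchy (T₂.small-cong′
  (λ { (m , n) → rearrange (seq x m) (seq x n) (seq y m) (seq y n) })
  (T₂.small-+ (cauchy→small (cauchy x)) (cauchy→small (cauchy y))))
  where
  rearrange : ∀ a b c d → (a ℚ.- b) ℚ.+ (c ℚ.- d) ≡ (a ℚ.+ c) ℚ.- (b ℚ.+ d)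
  rearrange = ℚS.solve 4 (λ a b c d →
    (a ℚS.:- b) ℚS.:+ (c ℚS.:- d) ℚS.:= (a ℚS.:+ c) ℚS.:- (b ℚS.:+ d)) refl

-ʳ_ : ℝ → ℝ
seq    (-ʳ x) n = ℚ.- seq x n
cauchy (-ʳ x) = small→cauchy (T₂.small-cong′
  (λ { (m , n) → ℚ.neg-distrib-+ (seq x m) (ℚ.- seq x n) })
  (T₂.small-neg (cauchy→small (cauchy x))))

_-ʳ_ : ℝ → ℝ → ℝ
x -ʳ y = x +ʳ (-ʳ y)

_*ʳ_ : ℝ → ℝ → ℝ
seq    (x *ʳ y) n = seq x n ℚ.* seq y n
cauchy (x *ʳ y) = small→cauchy (T₂.small-cong′
  (λ { (m , n) → rearrange (seq x m) (seq x n) (seq y m) (seq y n) })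
  (T₂.small-+
    (T₂.small-* (fst-bounded (bounded₁ (cauchy x))) (cauchy→small (cauchy y)))
    (T₂.small-* (snd-bounded (bounded₁ (cauchy y))) (cauchy→small (cauchy x)))))
  where
  rearrange : ∀ a b c d → a ℚ.* (c ℚ.- d) ℚ.+ d ℚ.* (a ℚ.- b) ≡ a ℚ.* c ℚ.- b ℚ.* d
  rearrange = ℚS.solve 4 (λ a b c d →
    a ℚS.:* (c ℚS.:- d) ℚS.:+ d ℚS.:* (a ℚS.:- b) ℚS.:= a ℚS.:* c ℚS.:- b ℚS.:* d) refl

fromℚ : ℚ → ℝ
seq    (fromℚ q) _ = q
cauchy (fromℚ q) = small→cauchy (T₂.small-0 λ _ → ℚ.+-inverseʳ q)

0ʳ 1ʳ : ℝ
0ʳ = fromℚ 0ℚ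
1ʳ = fromℚ 1ℚ

_<ʳ_ : ℝ → ℝ → Set
x <ʳ y = Positiveʳ (y -ʳ x)

≈ʳ-isEquivalence : IsEquivalence _≈ʳ_
≈ʳ-isEquivalence = record
  { refl  = seq≡⇒≈ʳ λ _ → refl
  ; sym   = λ {x} {y} e → small→≈ (T₁.small-cong′ (λ n → flip (seq x n) (seq y n)) (T₁.small-neg (≈→small e)))
  ; trans = λ {x} {y} {z} e f → small→≈ (T₁.small-cong′
              (λ n → telescope (seq x n) (seq y n) (seq z n)) (T₁.small-+ (≈→small e) (≈→small f)))
  }
  where
  flip : ∀ a b → ℚ.- (a ℚ.- b) ≡ b ℚ.- a
  flip = ℚS.solve 2 (λ a b → ℚS.:- (a ℚS.:- b) ℚS.:= b ℚS.:- a) refl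
  telescope : ∀ a b c → (a ℚ.- b) ℚ.+ (b ℚ.- c) ≡ a ℚ.- c
  telescope = ℚS.solve 3 (λ a b c → (a ℚS.:- b) ℚS.:+ (b ℚS.:- c) ℚS.:= a ℚS.:- c) refl

private
  module ≈ʳ = IsEquivalence ≈ʳ-isEquivalence

  +ʳ-cong : ∀ {x x′ y y′} → x ≈ʳ x′ → y ≈ʳ y′ → x +ʳ y ≈ʳ x′ +ʳ y′
  +ʳ-cong {x} {x′} {y} {y′} e f = small→≈ (T₁.small-cong′
    (λ n → rearrange (seq x n) (seq x′ n) (seq y n) (seq y′ n)) (T₁.small-+ (≈→small e) (≈→small f)))
    where
    rearrange : ∀ a b c d → (a ℚ.- b) ℚ.+ (c ℚ.- d) ≡ (a ℚ.+ c) ℚ.- (b ℚ.+ d)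
    rearrange = ℚS.solve 4 (λ a b c d →
      (a ℚS.:- b) ℚS.:+ (c ℚS.:- d) ℚS.:= (a ℚS.:+ c) ℚS.:- (b ℚS.:+ d)) refl

  -ʳ-cong : ∀ {x x′} → x ≈ʳ x′ → -ʳ x ≈ʳ -ʳ x′
  -ʳ-cong {x} {x′} e = small→≈ (T₁.small-cong′
    (λ n → ℚ.neg-distrib-+ (seq x n) (ℚ.- seq x′ n)) (T₁.small-neg (≈→small e)))

  *ʳ-cong : ∀ {x x′ y y′} → x ≈ʳ x′ → y ≈ʳ y′ → x *ʳ y ≈ʳ x′ *ʳ y′
  *ʳ-cong {x} {x′} {y} {y′} e f = small→≈ (T₁.small-cong′
    (λ n → rearrange (seq x n) (seq x′ n) (seq y n) (seq y′ n))
    (T₁.small-+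
      (T₁.small-* (bounded₁ (cauchy x)) (≈→small f))
      (T₁.small-* (bounded₁ (cauchy y′)) (≈→small e))))
    where
    rearrange : ∀ a b c d → a ℚ.* (c ℚ.- d) ℚ.+ d ℚ.* (a ℚ.- b) ≡ a ℚ.* c ℚ.- b ℚ.* d
    rearrange = ℚS.solve 4 (λ a b c d →
      a ℚS.:* (c ℚS.:- d) ℚS.:+ d ℚS.:* (a ℚS.:- b) ℚS.:= a ℚS.:* c ℚS.:- b ℚS.:* d) refl

ℝ-isCommutativeRing : IsCommutativeRing _≈ʳ_ _+ʳ_ _*ʳ_ -ʳ_ 0ʳ 1ʳ
ℝ-isCommutativeRing = record
  { isRing = record
    { +-isAbelianGroup = record
      { isGroup = record
        { isMonoid = record
          { isSemigroup = record
            { isMagma = record { isEquivalence = ≈ʳ-isEquivalence ; ∙-cong = +ʳ-cong }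
            ; assoc = λ x y z → seq≡⇒≈ʳ λ n → ℚ.+-assoc (seq x n) (seq y n) (seq z n)
            }
          ; identity = (λ x → seq≡⇒≈ʳ λ n → ℚ.+-identityˡ (seq x n))
                     , (λ x → seq≡⇒≈ʳ λ n → ℚ.+-identityʳ (seq x n))
          }
        ; inverse = (λ x → seq≡⇒≈ʳ λ n → ℚ.+-inverseˡ (seq x n))
                  , (λ x → seq≡⇒≈ʳ λ n → ℚ.+-inverseʳ (seq x n))
        ; ⁻¹-cong = -ʳ-cong
        }
      ; comm = λ x y → seq≡⇒≈ʳ λ n → ℚ.+-comm (seq x n) (seq y n)
      }
    ; *-cong = *ʳ-cong
    ; *-assoc = λ x y z → seq≡⇒≈ʳ λ n → ℚ.*-assoc (seq x n) (seq y n) (seq z n)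
    ; *-identity = (λ x → seq≡⇒≈ʳ λ n → ℚ.*-identityˡ (seq x n))
                 , (λ x → seq≡⇒≈ʳ λ n → ℚ.*-identityʳ (seq x n))
    ; distrib = (λ x y z → seq≡⇒≈ʳ λ n → ℚ.*-distribˡ-+ (seq x n) (seq y n) (seq z n))
              , (λ x y z → seq≡⇒≈ʳ λ n → ℚ.*-distribʳ-+ (seq x n) (seq y n) (seq z n))
    }
  ; *-comm = λ x y → seq≡⇒≈ʳ λ n → ℚ.*-comm (seq x n) (seq y n)
  }

ℝ-commutativeRing : CommutativeRing 0ℓ 0ℓ
ℝ-commutativeRing = record { isCommutativeRing = ℝ-isCommutativeRing }

positiveʳ-resp-≈ : ∀ {x y} → x ≈ʳ y → Positiveʳ x → Positiveʳ y
positiveʳ-resp-≈ {x} {y} e (mkPos δ 0<δ N h) =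
  mkPos (½ ℚ.* δ) (half-pos 0<δ) (proj₁ both) λ n p →
    let (d , δ<x) = proj₂ both n p in
    +-cancelʳ-<ℚ (½ ℚ.* δ) (begin-strict
      ½ ℚ.* δ ℚ.+ ½ ℚ.* δ                      ≡⟨ halves δ ⟩
      δ                                        <⟨ δ<x ⟩
      seq x n                                  ≡⟨ split (seq x n) (seq y n) ⟩
      seq y n ℚ.+ (seq x n ℚ.- seq y n)        ≤⟨ ℚ.+-monoʳ-≤ (seq y n) (p≤∣p∣ _) ⟩
      seq y n ℚ.+ ∣ seq x n ℚ.- seq y n ∣      <⟨ ℚ.+-monoʳ-< (seq y n) d ⟩
      seq y n ℚ.+ ½ ℚ.* δ                      ∎)
  where
  open ℚ.≤-Reasoning
  both = null e (½ ℚ.* δ) (half-pos 0<δ) T₁.& (N , h)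
  split : ∀ p q → p ≡ q ℚ.+ (p ℚ.- q)
  split = ℚS.solve 2 (λ p q → p ℚS.:= q ℚS.:+ (p ℚS.:- q)) refl

positiveʳ-+ : ∀ {x y} → Positiveʳ x → Positiveʳ y → Positiveʳ (x +ʳ y)
positiveʳ-+ (mkPos δ 0<δ M h) (mkPos ε 0<ε N k) =
  let (K , both) = (M , h) T₁.& (N , k) in
  mkPos (δ ℚ.+ ε) (ℚ.+-mono-< 0<δ 0<ε) K
    λ n p → let (q , r) = both n p in ℚ.+-mono-< q r

positiveʳ-* : ∀ {x y} → Positiveʳ x → Positiveʳ y → Positiveʳ (x *ʳ y)
positiveʳ-* {x} {y} (mkPos δ 0<δ M h) (mkPos ε 0<ε N k) =
  let (K , both) = (M , h) T₁.& (N , k) in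
  mkPos (δ ℚ.* ε) (pos-*ℚ 0<δ 0<ε) K
    λ n p → let (q , r) = both n p in
      ℚ.<-trans (ℚ.*-monoˡ-<-pos ε {{ℚ.positive 0<ε}} q)
        (ℚ.*-monoʳ-<-pos (seq x n) {{ℚ.positive (ℚ.<-trans 0<δ q)}} r)

positiveʳ-1 : Positiveʳ 1ʳ
positiveʳ-1 = mkPos ½ (ℚ.positive⁻¹ ½) 0 λ _ _ → ℚ.*<* (ℤ.+<+ ℕ.≤-refl)

recipʳ : (x : ℝ) → Positiveʳ x → ℝ
seq    (recipʳ x x>0) n = inv (seq x n)
cauchy (recipʳ x (mkPos δ 0<δ N h)) = small→cauchy (T₂.small-cong
  (N , λ { (m , n) (p , q) →
    rearrange (seq x m) (seq x n) (inv (seq x m)) (inv (seq x n))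
      (*-inv (ℚ.<-trans 0<δ (h m p))) (*-inv (ℚ.<-trans 0<δ (h n q))) })
  (T₂.small-* (T₂.bounded-* (fst-bounded bounded) (snd-bounded bounded))
    (T₂.small-neg (cauchy→small (cauchy x)))))
  where
  bounded : T₁.Bounded (λ n → inv (seq x n))
  bounded = T₁.mkBounded (inv δ ℚ.+ inv δ) (ℚ.+-mono-< (inv-pos 0<δ) (inv-pos 0<δ)) (N , λ n p →
    let 0<x = ℚ.<-trans 0<δ (h n p) in
    ℚ.≤-<-trans (ℚ.≤-trans (ℚ.≤-reflexive (abs-pos (inv-pos 0<x))) (inv-anti 0<δ (h n p)))
      (ℚ.≤-<-trans (ℚ.≤-reflexive (sym (ℚ.+-identityʳ (inv δ)))) (ℚ.+-monoʳ-< (inv δ) (inv-pos 0<δ))))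
  expand : ∀ a b i j → (i ℚ.* j) ℚ.* (ℚ.- (a ℚ.- b)) ≡ i ℚ.* (b ℚ.* j) ℚ.- j ℚ.* (a ℚ.* i)
  expand = ℚS.solve 4 (λ a b i j → (i ℚS.:* j) ℚS.:* (ℚS.:- (a ℚS.:- b))
    ℚS.:= i ℚS.:* (b ℚS.:* j) ℚS.:- j ℚS.:* (a ℚS.:* i)) refl
  rearrange : ∀ a b i j → a ℚ.* i ≡ 1ℚ → b ℚ.* j ≡ 1ℚ →
    (i ℚ.* j) ℚ.* (ℚ.- (a ℚ.- b)) ≡ i ℚ.- j
  rearrange a b i j e f = trans (expand a b i j)
    (cong₂ ℚ._-_ (trans (cong (i ℚ.*_) f) (ℚ.*-identityʳ i))
                 (trans (cong (j ℚ.*_) e) (ℚ.*-identityʳ j)))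

recipʳ-inverse : ∀ x (x>0 : Positiveʳ x) → x *ʳ recipʳ x x>0 ≈ʳ 1ʳ
recipʳ-inverse x (mkPos δ 0<δ N h) = small→≈ (T₁.small-cong {f = λ _ → 0ℚ}
  (N , λ n p → sym (trans (cong (ℚ._- 1ℚ) (*-inv (ℚ.<-trans 0<δ (h n p)))) (ℚ.+-inverseʳ 1ℚ)))
  (T₁.small-0 λ _ → refl))

record ℂ : Set where
  no-eta-equality
  constructor _+i_
  field
    re im : ℝ

open ℂ public

infix 4 _≈_

record _≈_ (z w : ℂ) : Set where
  constructor mk≈
  field
    re-≈ : re z ≈ʳ re w
    im-≈ : im z ≈ʳ im w

open _≈_ public

infixl 6 _+_ _-_
infixl 7 _*_
infix  8 -_

_+_ _*_ : ℂ → ℂ → ℂ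
re (z + w) = re z +ʳ re w
im (z + w) = im z +ʳ im w
re (z * w) = re z *ʳ re w -ʳ im z *ʳ im w
im (z * w) = re z *ʳ im w +ʳ im z *ʳ re w

-_ : ℂ → ℂ
re (- z) = -ʳ re z
im (- z) = -ʳ im z

_-_ : ℂ → ℂ → ℂ
z - w = z + (- w)

fromℝ : ℝ → ℂ
re (fromℝ x) = x
im (fromℝ x) = 0ʳ

0ℂ 1ℂ : ℂ
0ℂ = fromℝ 0ʳ
1ℂ = fromℝ 1ʳ

private
  module R where
    open CommutativeRing ℝ-commutativeRing public
      using (+-assoc; +-comm; +-identityˡ; +-identityʳ; -‿inverseˡ; -‿inverseʳ;
             +-cong; *-cong; -‿cong)

  ℚ⟶ℝ : CommutativeRing.rawRing ℚ.+-*-commutativeRing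
          -Raw-AlmostCommutative⟶ fromCommutativeRing ℝ-commutativeRing
  ℚ⟶ℝ = record
    { ⟦_⟧    = fromℚ
    ; +-homo = λ _ _ → seq≡⇒≈ʳ λ _ → refl
    ; *-homo = λ _ _ → seq≡⇒≈ʳ λ _ → refl
    ; -‿homo = λ _ → seq≡⇒≈ʳ λ _ → refl
    ; 0-homo = ≈ʳ.refl
    ; 1-homo = ≈ʳ.refl
    }

  fromℚ-≟ : ∀ p q → Maybe (fromℚ p ≈ʳ fromℚ q)
  fromℚ-≟ p q = Maybe.map (λ { refl → ≈ʳ.refl }) (dec⇒maybe (p ℚ.≟ q))

  open import Algebra.Solver.Ring (CommutativeRing.rawRing ℚ.+-*-commutativeRing)
    (fromCommutativeRing ℝ-commutativeRing) ℚ⟶ℝ fromℚ-≟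
    using (solve; _:=_; _:+_; _:*_; _:-_; :-_; con)

ℂ-isCommutativeRing : IsCommutativeRing _≈_ _+_ _*_ -_ 0ℂ 1ℂ
ℂ-isCommutativeRing = record
  { isRing = record
    { +-isAbelianGroup = record
      { isGroup = record
        { isMonoid = record
          { isSemigroup = record
            { isMagma = record
              { isEquivalence = record
                { refl  = mk≈ ≈ʳ.refl ≈ʳ.refl
                ; sym   = λ e → mk≈ (≈ʳ.sym (re-≈ e)) (≈ʳ.sym (im-≈ e))
                ; trans = λ e f → mk≈ (≈ʳ.trans (re-≈ e) (re-≈ f)) (≈ʳ.trans (im-≈ e) (im-≈ f))
                }
              ; ∙-cong = λ e f → mk≈ (R.+-cong (re-≈ e) (re-≈ f)) (R.+-cong (im-≈ e) (im-≈ f))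
              }
            ; assoc = λ x y z → mk≈ (R.+-assoc (re x) (re y) (re z)) (R.+-assoc (im x) (im y) (im z))
            }
          ; identity = (λ x → mk≈ (R.+-identityˡ (re x)) (R.+-identityˡ (im x)))
                     , (λ x → mk≈ (R.+-identityʳ (re x)) (R.+-identityʳ (im x)))
          }
        ; inverse = (λ x → mk≈ (R.-‿inverseˡ (re x)) (R.-‿inverseˡ (im x)))
                  , (λ x → mk≈ (R.-‿inverseʳ (re x)) (R.-‿inverseʳ (im x)))
        ; ⁻¹-cong = λ e → mk≈ (R.-‿cong (re-≈ e)) (R.-‿cong (im-≈ e))
        }
      ; comm = λ x y → mk≈ (R.+-comm (re x) (re y)) (R.+-comm (im x) (im y))
      }
    ; *-cong = *-cong
    ; *-assoc = *-assoc
    ; *-identity = (λ x → ≈-trans (*-comm 1ℂ x) (*-identityʳ x)) , *-identityʳ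
    ; distrib = *-distribˡ
              , λ x y z → ≈-trans (*-comm (y + z) x) (≈-trans (*-distribˡ x y z)
                  (+-cong (*-comm x y) (*-comm x z)))
    }
  ; *-comm = *-comm
  }
  where
  ≈-trans : ∀ {x y z} → x ≈ y → y ≈ z → x ≈ z
  ≈-trans e f = mk≈ (≈ʳ.trans (re-≈ e) (re-≈ f)) (≈ʳ.trans (im-≈ e) (im-≈ f))

  +-cong : ∀ {x x′ y y′} → x ≈ x′ → y ≈ y′ → x + y ≈ x′ + y′
  +-cong e f = mk≈ (R.+-cong (re-≈ e) (re-≈ f)) (R.+-cong (im-≈ e) (im-≈ f))

  *-cong : ∀ {x x′ y y′} → x ≈ x′ → y ≈ y′ → x * y ≈ x′ * y′
  *-cong (mk≈ e e′) (mk≈ f f′) = mk≈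
    (R.+-cong (R.*-cong e f) (R.-‿cong (R.*-cong e′ f′)))
    (R.+-cong (R.*-cong e f′) (R.*-cong e′ f))

  *-assoc : ∀ x y z → (x * y) * z ≈ x * (y * z)
  *-assoc x y z = mk≈
    (solve 6 (λ a b c d e f →
      ((a :* c :- ((b :* d))) :* e :- (((a :* d :+ b :* c) :* f))) :=
      (a :* (c :* e :- ((d :* f))) :- ((b :* (c :* f :+ d :* e))))) ≈ʳ.refl
      (re x) (im x) (re y) (im y) (re z) (im z))
    (solve 6 (λ a b c d e f →
      ((a :* c :- ((b :* d))) :* f :+ (a :* d :+ b :* c) :* e) :=
      (a :* (c :* f :+ d :* e) :+ b :* (c :* e :- ((d :* f))))) ≈ʳ.refl
      (re x) (im x) (re y) (im y) (re z) (im z))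

  *-comm : ∀ x y → x * y ≈ y * x
  *-comm x y = mk≈
    (solve 4 (λ a b c d → (a :* c :- ((b :* d))) := (c :* a :- ((d :* b)))) ≈ʳ.refl
      (re x) (im x) (re y) (im y))
    (solve 4 (λ a b c d → (a :* d :+ b :* c) := (c :* b :+ d :* a)) ≈ʳ.refl
      (re x) (im x) (re y) (im y))

  *-distribˡ : ∀ x y z → x * (y + z) ≈ x * y + x * z
  *-distribˡ x y z = mk≈
    (solve 6 (λ a b c d e f →
      (a :* (c :+ e) :- ((b :* (d :+ f)))) :=
      ((a :* c :- ((b :* d))) :+ (a :* e :- ((b :* f))))) ≈ʳ.refl
      (re x) (im x) (re y) (im y) (re z) (im z))
    (solve 6 (λ a b c d e f →
      (a :* (d :+ f) :+ b :* (c :+ e)) :=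
      ((a :* d :+ b :* c) :+ (a :* f :+ b :* e))) ≈ʳ.refl
      (re x) (im x) (re y) (im y) (re z) (im z))

  *-identityʳ : ∀ x → x * 1ℂ ≈ x
  *-identityʳ x = mk≈
    (solve 2 (λ a b → (a :* con 1ℚ :- b :* con 0ℚ) := a) ≈ʳ.refl (re x) (im x))
    (solve 2 (λ a b → (a :* con 0ℚ :+ b :* con 1ℚ) := b) ≈ʳ.refl (re x) (im x))

ℂ-commutativeRing : CommutativeRing 0ℓ 0ℓ
ℂ-commutativeRing = record { isCommutativeRing = ℂ-isCommutativeRing }

∣_∣² : ℂ → ℝ
∣ z ∣² = re z *ʳ re z +ʳ im z *ʳ im z

-- The constructive reading of z ≠ 0: the real number ∣ z ∣² is positive,
-- which is what division by z requires.
infix 4 _≉0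
record _≉0 (z : ℂ) : Set where
  constructor mk≉0
  field norm-positive : Positiveʳ ∣ z ∣²

open _≉0 public

private
  scale : ℝ → ℂ → ℂ
  re (scale r z) = r *ʳ re z
  im (scale r z) = r *ʳ im z

  conjugate : ℂ → ℂ
  re (conjugate z) = re z
  im (conjugate z) = -ʳ im z

reciprocal : (z : ℂ) → z ≉0 → ℂ
reciprocal z z≉0 = scale (recipʳ ∣ z ∣² (norm-positive z≉0)) (conjugate z)

reciprocal-inverse : ∀ z (z≉0 : z ≉0) → z * reciprocal z z≉0 ≈ 1ℂ
reciprocal-inverse z z≉0 = mk≈
  (≈ʳ.trans
    (solve 3 (λ a b r → (a :* (r :* a) :- b :* (r :* (:- b))) := ((a :* a :+ b :* b) :* r))
      ≈ʳ.refl (re z) (im z) r)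
    (recipʳ-inverse ∣ z ∣² (norm-positive z≉0)))
  (solve 3 (λ a b r → (a :* (r :* (:- b)) :+ b :* (r :* a)) := con 0ℚ) ≈ʳ.refl (re z) (im z) r)
  where r = recipʳ ∣ z ∣² (norm-positive z≉0)

*-≉0 : ∀ {z w} → z ≉0 → w ≉0 → z * w ≉0
*-≉0 {z} {w} z≉0 w≉0 = mk≉0 (positiveʳ-resp-≈
  (solve 4 (λ a b c d →
    ((a :* a :+ b :* b) :* (c :* c :+ d :* d)) :=
    ((a :* c :- b :* d) :* (a :* c :- b :* d) :+ (a :* d :+ b :* c) :* (a :* d :+ b :* c)))
    ≈ʳ.refl (re z) (im z) (re w) (im w))
  (positiveʳ-* (norm-positive z≉0) (norm-positive w≉0)))

-- z > 0 for a complex number z: z is real and positive.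
record Positive (z : ℂ) : Set where
  constructor mkPositive
  field
    re>0 : Positiveʳ (re z)
    im≈0 : im z ≈ʳ 0ʳ

positive-1 : Positive 1ℂ
positive-1 = mkPositive positiveʳ-1 ≈ʳ.refl

positive-+ : ∀ {z w} → Positive z → Positive w → Positive (z + w)
positive-+ (mkPositive p e) (mkPositive q f) =
  mkPositive (positiveʳ-+ p q) (≈ʳ.trans (R.+-cong e f) (R.+-identityˡ 0ʳ))

positive⇒≉0 : ∀ {z} → Positive z → z ≉0
positive⇒≉0 {z} (mkPositive p e) = mk≉0 (positiveʳ-resp-≈
  (≈ʳ.trans (solve 1 (λ a → (a :* a) := (a :* a :+ con 0ℚ :* con 0ℚ)) ≈ʳ.refl (re z))
    (R.+-cong ≈ʳ.refl (R.*-cong (≈ʳ.sym e) (≈ʳ.sym e))))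
  (positiveʳ-* p p))

open CommutativeRing ℂ-commutativeRing public using (semiring)
open import Algebra.Properties.Semiring.Exp semiring public using (_^_)
open import Algebra.Properties.Semiring.Mult semiring using () renaming (_×_ to _·_)

fromℕ : ℕ → ℂ
fromℕ n = n · 1ℂ

private
  positive-suc : ∀ n → Positive (fromℕ (suc n))
  positive-suc zero    = mkPositive
    (positiveʳ-resp-≈ (≈ʳ.sym (R.+-identityʳ 1ʳ)) positiveʳ-1) (R.+-identityʳ 0ʳ)
  positive-suc (suc n) = positive-+ positive-1 (positive-suc n)

positive-+-fromℕ : ∀ {z} → Positive z → ∀ n → Positive (z + fromℕ n)
positive-+-fromℕ {z} (mkPositive p e) zero = mkPositive
  (positiveʳ-resp-≈ (≈ʳ.sym (R.+-identityʳ (re z))) p)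
  (≈ʳ.trans (R.+-identityʳ (im z)) e)
positive-+-fromℕ p (suc n) = positive-+ p (positive-suc n)

fromℕ-≉0 : ∀ n → .{{ℕ.NonZero n}} → fromℕ n ≉0
fromℕ-≉0 (suc n) = positive⇒≉0 (positive-suc n)

record ℂˣ : Set where
  no-eta-equality
  constructor nonzero
  field
    value : ℂ
    apart : value ≉0

open ℂˣ public

infixl 7 _/_ _*ˣ_
infixr 8 _^ˣ_

_/_ : ℂ → ℂˣ → ℂ
z / w = z * reciprocal (value w) (apart w)

1ˣ : ℂˣ
1ˣ = nonzero 1ℂ (positive⇒≉0 positive-1)

_*ˣ_ : ℂˣ → ℂˣ → ℂˣ
z *ˣ w = nonzero (value z * value w) (*-≉0 (apart z) (apart w))

_^ˣ_ : ℂˣ → ℕ → ℂˣ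
z ^ˣ zero  = 1ˣ
z ^ˣ suc n = z *ˣ z ^ˣ n

fromℕˣ : (n : ℕ) → .{{ℕ.NonZero n}} → ℂˣ
fromℕˣ n = nonzero (fromℕ n) (fromℕ-≉0 n)

factorial : ℕ → ℂˣ
factorial n = fromℕˣ (n !) {{ℕ._!≢0 n}}

-- sum≤ _∙_ n f = f 0 ∙ f 1 ∙ … ∙ f n
sum≤ : ∀ {A : Set} → (A → A → A) → ℕ → (ℕ → A) → A
sum≤ _∙_ zero    f = f 0
sum≤ _∙_ (suc n) f = sum≤ _∙_ n f ∙ f (suc n)

∑ : ℕ → (ℕ → ℂ) → ℂ
∑ = sum≤ _+_

-- Comparing squared moduli with every ε > 0 is the usual convergence.
record _⟶_ (s : ℕ → ℂ) (l : ℂ) : Set where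
  field
    converges : ∀ (ε : ℝ) → Positiveʳ ε →
      ∃[ N ] (∀ n → N ℕ.≤ n → ∣ s n - l ∣² <ʳ ε)

-- exp z = w
Exp : ℂ → ℂ → Set
Exp z w = (λ n → ∑ n λ j → z ^ j / factorial j) ⟶ w

-- A value of C^α is exp (α * L) for a choice of L with exp L = C.  The
-- field power-≉0 is no restriction, as exp has no zeros; it is the
-- witness by which C^(-α) = 1 / C^α is formed.
record Power (C α : ℂ) : Set where
  field
    logarithm     : ℂ
    exp-logarithm : Exp logarithm C
    power         : ℂ
    exp-power     : Exp (α * logarithm) power
    power-≉0      : power ≉0

  powerˣ : ℂˣ
  powerˣ = nonzero power power-≉0

open Power public using (powerˣ)

-- Coefficients in increasing degree.
Poly : Set
Poly = List ℂ

coeff : Poly → ℕ → ℂ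
coeff []      _       = 0ℂ
coeff (a ∷ p) zero    = a
coeff (a ∷ p) (suc k) = coeff p k

infix 4 _≈ₚ_

-- Trailing zero coefficients are irrelevant.
record _≈ₚ_ (p q : Poly) : Set where
  constructor mk≈ₚ
  field coeff-≈ : ∀ k → coeff p k ≈ coeff q k

open _≈ₚ_ public

infixl 6 _+ₚ_
infixl 7 _*ₚ_
infixr 7 _·ₚ_
infixr 8 _^ₚ_

_+ₚ_ _*ₚ_ : Poly → Poly → Poly
[]      +ₚ q       = q
(a ∷ p) +ₚ []      = a ∷ p
(a ∷ p) +ₚ (b ∷ q) = a + b ∷ p +ₚ q

_·ₚ_ : ℂ → Poly → Poly
c ·ₚ p = map (c *_) p

[]      *ₚ q = []
(a ∷ p) *ₚ q = a ·ₚ q +ₚ (0ℂ ∷ p *ₚ q)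

0ₚ 1ₚ X : Poly
0ₚ = []
1ₚ = 1ℂ ∷ []
X  = 0ℂ ∷ 1ℂ ∷ []

_^ₚ_ : Poly → ℕ → Poly
p ^ₚ zero  = 1ₚ
p ^ₚ suc n = p *ₚ p ^ₚ n

∑ₚ : ℕ → (ℕ → Poly) → Poly
∑ₚ = sum≤ _+ₚ_

-- Formal power series in t whose coefficients are polynomials in x.
Series : Set
Series = ℕ → Poly

infixl 7 _*ₛ_
infixr 8 _^ₛ_

1ₛ : Series
1ₛ zero    = 1ₚ
1ₛ (suc n) = 0ₚ

_*ₛ_ : Series → Series → Series
(f *ₛ g) n = ∑ₚ n λ i → f i *ₚ g (n ℕ.∸ i)

_^ₛ_ : Series → ℕ → Series
f ^ₛ zero  = 1ₛ
f ^ₛ suc m = f *ₛ f ^ₛ m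

falling : ℂ → ℕ → ℂ
falling α zero    = 1ℂ
falling α (suc m) = falling α m * (α - fromℕ m)

binomial : ℂ → ℕ → ℂ
binomial α m = falling α m / factorial m

-- (1 + u)^α = ∑ₘ binomial α m u^m for a series u with zero constant
-- term; then u^m has no terms below t^m, so that only the powers with
-- m ≤ n contribute to the coefficient of t^n.
[1+_]^_ : Series → ℂ → Series
([1+ u ]^ α) n = ∑ₚ n λ m → binomial α m ·ₚ (u ^ₛ m) n

rising : ℂ → ℕ → ℂ
rising z zero    = 1ℂ
rising z (suc r) = rising z r * (z + fromℕ r)

risingˣ : ∀ {z} → Positive z → ℕ → ℂˣ
risingˣ {z} z>0 r = nonzero (rising z r) (go r)
  where
  go : ∀ r → rising z r ≉0
  go zero    = positive⇒≉0 positive-1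
  go (suc r) = *-≉0 (go r) (positive⇒≉0 (positive-+-fromℕ z>0 r))

Matrix : Set
Matrix = ℕ → ℕ → ℂ

LowerTriangular : Matrix → Set
LowerTriangular M = ∀ n k → n ℕ.< k → M n k ≈ 0ℂ

-- The matrix product for a lower triangular first factor, whose rows are
-- supported on 0 … n.
_⊗_ : Matrix → Matrix → Matrix
(M ⊗ N) n k = ∑ n λ j → M n j * N j k

identity : Matrix
identity n k with n ℕ.≟ k
... | yes _ = 1ℂ
... | no  _ = 0ℂ

record Inverse (A B : Matrix) : Set where
  field
    lower-A  : LowerTriangular A
    lower-B  : LowerTriangular B
    inverseʳ : ∀ n k → (A ⊗ B) n k ≈ identity n k
    inverseˡ : ∀ n k → (B ⊗ A) n k ≈ identity n k

-- f r s with r = (n + k) / 2 and s = (n - k) / 2 if n - k ≥ 0 is even,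
-- and 0 otherwise.
ifEven : (ℕ → ℕ → ℂ) → Matrix
ifEven f n k with k ℕ.≤? n | 2 ℕ.∣? (n ℕ.∸ k)
... | yes _ | yes _ = f ((n ℕ.+ k) ℕ./ 2) ((n ℕ.∸ k) ℕ./ 2)
... | _     | _     = 0ℂ

module Gegenbauer (lam y C : ℂ) (lam>0 : Positive lam) (C≉0 : C ≉0)
                  (C^lam : Power C lam) where

  Cˣ : ℂˣ
  Cˣ = nonzero C C≉0

  -- C^(lam+m) = C^lam C^m
  C^lam+ : ℕ → ℂˣ
  C^lam+ m = powerˣ C^lam *ˣ Cˣ ^ˣ m

  -- -(2x/C) t + (y/C) t²
  u : Series
  u 1 = (- (fromℕ 2 / Cˣ)) ·ₚ X
  u 2 = (y / Cˣ) ·ₚ 1ₚ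
  u _ = 0ₚ

  -- (C - 2xt + yt²)^(-lam) = C^(-lam) (1 + u)^(-lam)
  generating : Series
  generating n = (1ℂ / powerˣ C^lam) ·ₚ ([1+ u ]^ (- lam)) n

  P : ℕ → Poly
  P n = generating n

  A : Matrix
  A n k = coeff (P n) k

  a : Matrix
  a n k = ifEven (λ r s →
    (rising lam r * fromℕ 2 ^ k * (- y) ^ s) / (factorial k *ˣ factorial s *ˣ C^lam+ r)) n k

  b : Matrix
  b n k = ifEven (λ r s →
    (value (factorial n) * (lam + fromℕ k) * y ^ s * value (C^lam+ r))
      / (fromℕˣ 2 ^ˣ n *ˣ factorial s *ˣ risingˣ lam>0 (suc r))) n k

{-# OPTIONS --safe #-}

-- Expanding (1 + u)^(-λ) with u = αxt + βt², α = -2/C, β = y/C, the coefficient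
-- of x^k t^(k+2s) comes from the power u^(k+s) alone and equals
-- binom(k+s, k) α^k β^s, which gives the entries of A.
--
-- In both b ⊗ A and A ⊗ b the entry at (k+2N, k) is, up to a factor that does not
-- depend on i, a sum over i + d = N of y^d (-y)^i h i / (i! d!) or of
-- (-y)^d y^i h i / (i! d!).  For N > 0 it telescopes to 0: its partial sums are
-- d y^d (-y)^i g i / (N i! d!) as soon as h 0 = g 0 and
-- N h (i+1) = d g (i+1) + (i+1) g i.  With (z)_m the rising factorial,
--   b ⊗ A:  h i = (λ+k+2i) (λ)_(i+k) / (λ)_(N+i+k+1),
--           g i = (λ)_(i+k+1) / (λ)_(N+i+k+1);
--   A ⊗ b:  h i = (λ)_(N+i+k) / (λ)_(i+k+1),
--           g i = (λ)_(N+i+k+1) / ((λ)_(i+k+1) (λ+N+k)).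

module Submission where

open import Algebra.Bundles using (CommutativeRing)
open import Algebra.Solver.Ring.AlmostCommutativeRing
  using (fromCommutativeRing; _-Raw-AlmostCommutative⟶_)
open import Data.Empty using (⊥-elim)
open import Data.List.Base using ([]; _∷_)
open import Data.Maybe.Base as Maybe using (Maybe)
open import Data.Nat.Base as ℕ using (ℕ; zero; suc; z≤n; s≤s; _!)
import Data.Nat.DivMod as ℕ
import Data.Nat.Divisibility as ℕ
import Data.Nat.Properties as ℕ
open import Data.Nat.Solver using (module +-*-Solver)
open import Data.Product.Base using (_×_; _,_; ∃-syntax)
open import Data.Rational.Base using (ℚ; 1ℚ)
import Data.Rational.Properties as ℚ
open import Data.Sum.Base using (_⊎_; inj₁; inj₂; [_,_]′)
open import Relation.Binary.PropositionalEquality as ≡ using (_≡_; _≢_)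
open import Relation.Nullary.Decidable.Core using (yes; no; dec⇒maybe)
open import Relation.Nullary.Negation.Core using (¬_)
open import Defs

open CommutativeRing ℂ-commutativeRing
  using (refl; sym; trans; reflexive; setoid; +-cong; +-congˡ; +-congʳ; *-cong; *-congˡ; *-congʳ;
         -‿cong; +-identityˡ; +-identityʳ; *-identityˡ; *-identityʳ; zeroˡ; zeroʳ;
         *-comm; *-assoc; distribˡ)
open import Algebra.Properties.Semiring.Exp semiring using (^-homo-*; ^-congˡ)
open import Algebra.Properties.CommutativeSemiring.Exp
  (CommutativeRing.commutativeSemiring ℂ-commutativeRing) using (^-distrib-*)
open import Algebra.Properties.Semiring.Mult semiring using (×-homo-+; ×1-homo-*)
open import Relation.Binary.Reasoning.Setoid setoid

-- The ring solver over ℂ with rational constants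

private
  module Real = CommutativeRing ℝ-commutativeRing

  ℚ⟶ℂ : CommutativeRing.rawRing ℚ.+-*-commutativeRing
          -Raw-AlmostCommutative⟶ fromCommutativeRing ℂ-commutativeRing
  ℚ⟶ℂ = record
    { ⟦_⟧    = λ q → fromℝ (fromℚ q)
    -- `ℝ` has no eta and the two Cauchy proofs differ, so the two reals are not definitionally
    -- equal. Their sequences are, and the field `null` of reflexivity fits once it is wrapped
    -- again.
    ; +-homo = λ p q → mk≈ (mk≈ʳ (null (Real.refl {fromℚ p +ʳ fromℚ q}))) (Real.sym (Real.+-identityʳ 0ʳ))
    ; *-homo = λ p q → mk≈
        (Real.trans (mk≈ʳ (null (Real.refl {fromℚ p *ʳ fromℚ q})))
          (Real.trans (Real.sym (Real.+-identityʳ _))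
            (Real.+-congˡ (Real.trans (Real.sym -0ʳ≈0ʳ) (Real.-‿cong (Real.sym (Real.zeroˡ 0ʳ)))))))
        (Real.sym (Real.trans (Real.+-cong (Real.zeroʳ _) (Real.zeroˡ _)) (Real.+-identityʳ 0ʳ)))
    ; -‿homo = λ q → mk≈ (mk≈ʳ (null (Real.refl { -ʳ fromℚ q}))) (Real.sym -0ʳ≈0ʳ)
    ; 0-homo = refl
    ; 1-homo = refl
    }
    where
    -0ʳ≈0ʳ : -ʳ 0ʳ ≈ʳ 0ʳ
    -0ʳ≈0ʳ = Real.trans (Real.sym (Real.+-identityˡ (-ʳ 0ʳ))) (Real.-‿inverseʳ 0ʳ)

  fromℚ-≟ : ∀ p q → Maybe (fromℝ (fromℚ p) ≈ fromℝ (fromℚ q))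
  fromℚ-≟ p q = Maybe.map (λ { ≡.refl → refl }) (dec⇒maybe (p ℚ.≟ q))

open import Algebra.Solver.Ring (CommutativeRing.rawRing ℚ.+-*-commutativeRing)
  (fromCommutativeRing ℂ-commutativeRing) ℚ⟶ℂ fromℚ-≟
  using (solve; _:=_; _:+_; _:*_; _:-_; :-_; con)

open +-*-Solver using ()
  renaming (solve to solveℕ; _:=_ to _:=ℕ_; _:+_ to _:+ℕ_; _:*_ to _:*ℕ_; con to conℕ)

-- Division

infix 9 _⁻¹

_⁻¹ : ℂˣ → ℂ
w ⁻¹ = reciprocal (value w) (apart w)

⁻¹-inverse : ∀ w → value w * w ⁻¹ ≈ 1ℂ
⁻¹-inverse w = reciprocal-inverse (value w) (apart w)

/-unique : ∀ {z x} w → z ≈ x * value w → z / w ≈ x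
/-unique {z} {x} w e = begin
  z * w ⁻¹              ≈⟨ *-congʳ e ⟩
  x * value w * w ⁻¹    ≈⟨ *-assoc x _ _ ⟩
  x * (value w * w ⁻¹)  ≈⟨ *-congˡ (⁻¹-inverse w) ⟩
  x * 1ℂ                ≈⟨ *-identityʳ x ⟩
  x                     ∎

/-cancel : ∀ z w → z / w * value w ≈ z
/-cancel z w = begin
  z * w ⁻¹ * value w    ≈⟨ solve 3 (λ z w v → z :* v :* w := z :* (w :* v)) refl z (value w) (w ⁻¹) ⟩
  z * (value w * w ⁻¹)  ≈⟨ *-congˡ (⁻¹-inverse w) ⟩
  z * 1ℂ                ≈⟨ *-identityʳ z ⟩
  z                     ∎

*-cancelʳ : ∀ {x y} w → x * value w ≈ y * value w → x ≈ y
*-cancelʳ {x} {y} w e = trans (sym (/-unique w refl)) (/-unique w e)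

value-^ˣ : ∀ w n → value (w ^ˣ n) ≈ value w ^ n
value-^ˣ w zero    = refl
value-^ˣ w (suc n) = *-congˡ (value-^ˣ w n)

-- Multiplying by w turns z/v into v/v = 1. This is the rule by which factors cancel in reciprocals
-- of factorials and of rising factorials.
⁻¹-absorb : ∀ {z} w v → value w * z ≈ value v → z * v ⁻¹ ≈ w ⁻¹
⁻¹-absorb {z} w v e = *-cancelʳ w (begin
  z * v ⁻¹ * value w    ≈⟨ solve 3 (λ z v w → z :* v :* w := w :* z :* v) refl z (v ⁻¹) (value w) ⟩
  value w * z * v ⁻¹    ≈⟨ *-congʳ e ⟩
  value v * v ⁻¹        ≈⟨ ⁻¹-inverse v ⟩
  1ℂ                    ≈⟨ ⁻¹-inverse w ⟨
  value w * w ⁻¹        ≈⟨ *-comm _ _ ⟩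
  w ⁻¹ * value w        ∎)

-- A reciprocal is formed from a proof of apartness; this shows that its value does not depend on
-- that proof.
⁻¹-cong : ∀ w v → value w ≈ value v → w ⁻¹ ≈ v ⁻¹
⁻¹-cong w v e = trans (sym (⁻¹-absorb w v (trans (*-identityʳ _) e))) (*-identityˡ _)

⁻¹-distrib-* : ∀ w v → (w *ˣ v) ⁻¹ ≈ w ⁻¹ * v ⁻¹
⁻¹-distrib-* w v = begin
  (w *ˣ v) ⁻¹                        ≈⟨ *-identityˡ _ ⟨
  1ℂ * (w *ˣ v) ⁻¹                   ≈⟨ *-congʳ (⁻¹-inverse w) ⟨
  value w * w ⁻¹ * (w *ˣ v) ⁻¹       ≈⟨ solve 3 (λ w i x → w :* i :* x := i :* (w :* x)) refl (value w) (w ⁻¹) _ ⟩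
  w ⁻¹ * (value w * (w *ˣ v) ⁻¹)     ≈⟨ *-congˡ (⁻¹-absorb v (w *ˣ v) (*-comm _ _)) ⟩
  w ⁻¹ * v ⁻¹                        ∎

fromℕ-+ : ∀ m n → fromℕ (m ℕ.+ n) ≈ fromℕ m + fromℕ n
fromℕ-+ = ×-homo-+ 1ℂ

fromℕ-1 : fromℕ 1 ≈ 1ℂ
fromℕ-1 = +-identityʳ 1ℂ

factorial-suc : ∀ n → value (factorial (suc n)) ≈ value (factorial n) * fromℕ (suc n)
factorial-suc n = trans (×1-homo-* (suc n) (n !)) (*-comm _ _)

factorial-suc-⁻¹ : ∀ n → fromℕ (suc n) * factorial (suc n) ⁻¹ ≈ factorial n ⁻¹
factorial-suc-⁻¹ n = ⁻¹-absorb (factorial n) (factorial (suc n)) (sym (factorial-suc n))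

factorial-0-⁻¹ : factorial 0 ⁻¹ ≈ 1ℂ
factorial-0-⁻¹ = trans (⁻¹-cong (factorial 0) 1ˣ fromℕ-1) (trans (sym (*-identityˡ _)) (⁻¹-inverse 1ˣ))

⁻¹-^ˣ : ∀ w n → (w ^ˣ n) ⁻¹ ≈ w ⁻¹ ^ n
⁻¹-^ˣ w zero    = trans (sym (*-identityˡ _)) (⁻¹-inverse 1ˣ)
⁻¹-^ˣ w (suc n) = trans (⁻¹-distrib-* w (w ^ˣ n)) (*-congˡ (⁻¹-^ˣ w n))

/-*ˣ : ∀ z w₁ w₂ w₃ → z / (w₁ *ˣ w₂ *ˣ w₃) ≈ z * (w₁ ⁻¹ * w₂ ⁻¹ * w₃ ⁻¹)
/-*ˣ z w₁ w₂ w₃ = *-congˡ (trans (⁻¹-distrib-* (w₁ *ˣ w₂) w₃) (*-congʳ (⁻¹-distrib-* w₁ w₂)))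

⁻¹-*-^ : ∀ w v x n → value w ≈ value v * value x ^ n → w ⁻¹ ≈ v ⁻¹ * x ⁻¹ ^ n
⁻¹-*-^ w v x n e = trans
  (⁻¹-cong w (v *ˣ x ^ˣ n) (trans e (*-congˡ (sym (value-^ˣ x n)))))
  (trans (⁻¹-distrib-* v (x ^ˣ n)) (*-congˡ (⁻¹-^ˣ x n)))

^-inverse : ∀ {z w} n → z * w ≈ 1ℂ → z ^ n * w ^ n ≈ 1ℂ
^-inverse {z} {w} n e = trans (sym (^-distrib-* z w n)) (trans (^-congˡ n e) (1^n≈1 n))
  where
  1^n≈1 : ∀ n → 1ℂ ^ n ≈ 1ℂ
  1^n≈1 zero    = refl
  1^n≈1 (suc n) = trans (*-identityˡ _) (1^n≈1 n)

-- Finite sums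

∑-cong : ∀ n {f g} → (∀ i → i ℕ.≤ n → f i ≈ g i) → ∑ n f ≈ ∑ n g
∑-cong zero    e = e 0 z≤n
∑-cong (suc n) e = +-cong (∑-cong n (λ i i≤n → e i (ℕ.m≤n⇒m≤1+n i≤n))) (e (suc n) ℕ.≤-refl)

∑-zero : ∀ n {f} → (∀ i → i ℕ.≤ n → f i ≈ 0ℂ) → ∑ n f ≈ 0ℂ
∑-zero zero    e = e 0 z≤n
∑-zero (suc n) e = trans
  (+-cong (∑-zero n (λ i i≤n → e i (ℕ.m≤n⇒m≤1+n i≤n))) (e (suc n) ℕ.≤-refl)) (+-identityˡ 0ℂ)

∑-distribˡ : ∀ n {f} c → ∑ n (λ i → c * f i) ≈ c * ∑ n f
∑-distribˡ zero    c = refl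
∑-distribˡ (suc n) c = trans (+-congʳ (∑-distribˡ n c)) (sym (distribˡ c _ _))

∑-single : ∀ n {f} m → m ℕ.≤ n → (∀ i → i ≢ m → f i ≈ 0ℂ) → ∑ n f ≈ f m
∑-single zero    zero z≤n e = refl
∑-single (suc n) {f} m m≤1+n e with m ℕ.≟ suc n
... | yes ≡.refl = trans
  (+-congʳ (∑-zero n (λ i i≤n → e i (ℕ.<⇒≢ (s≤s i≤n))))) (+-identityˡ _)
... | no m≢1+n = trans
  (+-cong (∑-single n m (ℕ.≤-pred (ℕ.≤∧≢⇒< m≤1+n m≢1+n)) e) (e (suc n) (λ eq → m≢1+n (≡.sym eq))))
  (+-identityʳ _)

-- Raising N by one appends two indices; the first lies at odd distance from k, so its term
-- vanishes. In the base case the indices below k drop out, as every i * 2 + k is at least k.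
∑-even : ∀ N k {f} → (∀ j → (∀ i → j ≢ i ℕ.* 2 ℕ.+ k) → f j ≈ 0ℂ) →
  ∑ (N ℕ.* 2 ℕ.+ k) f ≈ ∑ N (λ i → f (i ℕ.* 2 ℕ.+ k))
∑-even zero k {f} e = below k ℕ.≤-refl
  where
  below : ∀ m → m ℕ.≤ k → ∑ m f ≈ f m
  below zero    _   = refl
  below (suc m) m<k = trans (+-congʳ (∑-zero m λ i i≤m → e i λ j eq →
      ℕ.<⇒≱ (ℕ.≤-<-trans i≤m m<k) (ℕ.≤-trans (ℕ.m≤n+m k (j ℕ.* 2)) (ℕ.≤-reflexive (≡.sym eq)))))
    (+-identityˡ _)
∑-even (suc N) k {f} e = +-congʳ (trans
  (+-cong (∑-even N k e) (e _ λ i eq → odd i N (ℕ.+-cancelʳ-≡ k _ _ (≡.sym eq))))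
  (+-identityʳ _))
  where
  odd : ∀ i N → i ℕ.* 2 ≢ suc (N ℕ.* 2)
  odd zero    N       ()
  odd (suc i) zero    ()
  odd (suc i) (suc N) eq = odd i N (ℕ.suc-injective (ℕ.suc-injective eq))

-- Made for Cauchy products with first factor `u`, whose only terms are those in t and t².
∑-middle : ∀ n {f} → f 0 ≈ 0ℂ → (∀ i → f (3 ℕ.+ i) ≈ 0ℂ) → ∑ (2 ℕ.+ n) f ≈ f 1 + f 2
∑-middle zero    e₀ e = +-congʳ (trans (+-congʳ e₀) (+-identityˡ _))
∑-middle (suc n) e₀ e = trans (+-cong (∑-middle n e₀ e) (e n)) (+-identityʳ _)

-- Matrices supported on the entries with n - k even and nonnegative

-- The number (n - k)/2, given by an equation free of truncated subtraction and division: matching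
-- on `refl` replaces n. The order s * 2 is the one that `ℕ.divides` supplies, and it unfolds to two
-- successors when s is a successor.
Offset : ℕ → ℕ → ℕ → Set
Offset s n k = n ≡ s ℕ.* 2 ℕ.+ k

EvenSupport : Matrix → Set
EvenSupport M = ∀ n k → (∀ s → ¬ Offset s n k) → M n k ≈ 0ℂ

offset? : ∀ n k → (∃[ s ] Offset s n k) ⊎ (∀ s → ¬ Offset s n k)
offset? n k with k ℕ.≤? n | 2 ℕ.∣? (n ℕ.∸ k)
... | yes k≤n | yes (ℕ.divides s eq) =
  inj₁ (s , ≡.trans (≡.sym (ℕ.m∸n+n≡m k≤n)) (≡.cong (ℕ._+ k) eq))
... | yes k≤n | no 2∤ = inj₂ λ { s ≡.refl → 2∤ (ℕ.divides s (ℕ.m+n∸n≡m (s ℕ.* 2) k)) }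
... | no k≰n  | _     = inj₂ λ { s ≡.refl → k≰n (ℕ.m≤n+m k (s ℕ.* 2)) }

-- Here f also takes n and k because the bodies in `a` and `b` mention them.
ifEven-support : ∀ (f : ℕ → ℕ → ℕ → ℕ → ℂ) → EvenSupport (λ n k → ifEven (f n k) n k)
ifEven-support f n k none with k ℕ.≤? n | 2 ℕ.∣? (n ℕ.∸ k)
... | yes k≤n | yes (ℕ.divides s eq) =
  ⊥-elim (none s (≡.trans (≡.sym (ℕ.m∸n+n≡m k≤n)) (≡.cong (ℕ._+ k) eq)))
... | yes _ | no _ = refl
... | no _  | _    = refl

ifEven-offset : ∀ f s {n} k → Offset s n k → ifEven f n k ≡ f (s ℕ.+ k) s
ifEven-offset f s k ≡.refl with k ℕ.≤? s ℕ.* 2 ℕ.+ k | 2 ℕ.∣? (s ℕ.* 2 ℕ.+ k ℕ.∸ k)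
... | yes _ | yes _ = ≡.cong₂ f
  (≡.trans (≡.cong (ℕ._/ 2) (double s k)) (ℕ.m*n/n≡m (s ℕ.+ k) 2))
  (≡.trans (≡.cong (ℕ._/ 2) (ℕ.m+n∸n≡m (s ℕ.* 2) k)) (ℕ.m*n/n≡m s 2))
  where
  double : ∀ s k → s ℕ.* 2 ℕ.+ k ℕ.+ k ≡ (s ℕ.+ k) ℕ.* 2
  double = solveℕ 2 (λ s k → s :*ℕ conℕ 2 :+ℕ k :+ℕ k :=ℕ (s :+ℕ k) :*ℕ conℕ 2) ≡.refl
... | yes _ | no 2∤ = ⊥-elim (2∤ (ℕ.divides s (ℕ.m+n∸n≡m (s ℕ.* 2) k)))
... | no k≰ | _     = ⊥-elim (k≰ (ℕ.m≤n+m k (s ℕ.* 2)))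

evenSupport-lower : ∀ {M} → EvenSupport M → LowerTriangular M
evenSupport-lower even n k n<k = even n k λ { s ≡.refl → ℕ.<⇒≱ n<k (ℕ.m≤n+m k (s ℕ.* 2)) }

identity-≡ : ∀ n → identity n n ≈ 1ℂ
identity-≡ n with n ℕ.≟ n
... | yes _  = refl
... | no n≢n = ⊥-elim (n≢n ≡.refl)

identity-≢ : ∀ {n k} → n ≢ k → identity n k ≈ 0ℂ
identity-≢ {n} {k} n≢k with n ℕ.≟ k
... | yes n≡k = ⊥-elim (n≢k n≡k)
... | no _    = refl

evenSupport-⊗ : ∀ {M M′} → EvenSupport M → EvenSupport M′ → ∀ N k →
  (M ⊗ M′) (N ℕ.* 2 ℕ.+ k) k ≈ ∑ N (λ i → M (N ℕ.* 2 ℕ.+ k) (i ℕ.* 2 ℕ.+ k) * M′ (i ℕ.* 2 ℕ.+ k) k)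
evenSupport-⊗ even even′ N k = ∑-even N k λ j none → trans (*-congˡ (even′ j k none)) (zeroʳ _)

-- Offsets add: s from n to j and t from j to k make s + t from n to k, so a nonzero summand would
-- give n and k an offset.
⊗-evenSupport : ∀ {M M′} → EvenSupport M → EvenSupport M′ → EvenSupport (M ⊗ M′)
⊗-evenSupport {M} {M′} even even′ n k none = ∑-zero n vanish
  where
  vanish : ∀ j → j ℕ.≤ n → M n j * M′ j k ≈ 0ℂ
  vanish j _ with offset? n j | offset? j k
  ... | inj₂ no₁ | _ = trans (*-congʳ (even n j no₁)) (zeroˡ _)
  ... | inj₁ _ | inj₂ no₂ = trans (*-congˡ (even′ j k no₂)) (zeroʳ _)
  ... | inj₁ (s , ≡.refl) | inj₁ (t , ≡.refl) = ⊥-elim (none (s ℕ.+ t)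
    (≡.trans (≡.sym (ℕ.+-assoc (s ℕ.* 2) (t ℕ.* 2) k))
      (≡.cong (ℕ._+ k) (≡.sym (ℕ.*-distribʳ-+ 2 s t)))))

⊗-cong : ∀ {M₁ M₂ M₃ M₄} → (∀ n k → M₁ n k ≈ M₂ n k) → (∀ n k → M₃ n k ≈ M₄ n k) →
  ∀ n k → (M₁ ⊗ M₃) n k ≈ (M₂ ⊗ M₄) n k
⊗-cong e f n k = ∑-cong n λ j _ → *-cong (e n j) (f j k)

-- There are three cases. Without an offset both sides vanish, since n = k would have offset 0;
-- offset 0 leaves one summand; a positive offset leaves the sum that is later shown to telescope.
⊗≈identity : ∀ {M M′} → EvenSupport M → EvenSupport M′ →
  (∀ k → M k k * M′ k k ≈ 1ℂ) →
  (∀ N k → .{{_ : ℕ.NonZero N}} →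
    ∑ N (λ i → M (N ℕ.* 2 ℕ.+ k) (i ℕ.* 2 ℕ.+ k) * M′ (i ℕ.* 2 ℕ.+ k) k) ≈ 0ℂ) →
  ∀ n k → (M ⊗ M′) n k ≈ identity n k
⊗≈identity even even′ diagonal off n k with offset? n k
... | inj₂ none = trans (⊗-evenSupport even even′ n k none) (sym (identity-≢ (none 0)))
... | inj₁ (zero , ≡.refl) =
  trans (evenSupport-⊗ even even′ 0 k) (trans (diagonal k) (sym (identity-≡ k)))
... | inj₁ (N@(suc N′) , ≡.refl) = trans (evenSupport-⊗ even even′ N k)
  (trans (off N k) (sym (identity-≢ λ eq → ℕ.<⇒≢ (s≤s (ℕ.m≤n+m k (suc (N′ ℕ.* 2)))) (≡.sym eq))))

-- A telescoping sum

module Telescope (y y′ : ℂ) (y≈-y′ : y ≈ - y′) where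

  -- For i + d = N these are the terms of the binomial expansion of (y + y′)^N / N!, where y + y′ =
  -- 0.
  weight : ℕ → ℕ → ℂ
  weight i d = y ^ d * y′ ^ i * (factorial i ⁻¹ * factorial d ⁻¹)

  weight-0-0 : weight 0 0 ≈ 1ℂ
  weight-0-0 = begin
    1ℂ * 1ℂ * (factorial 0 ⁻¹ * factorial 0 ⁻¹) ≈⟨ *-congˡ (*-cong factorial-0-⁻¹ factorial-0-⁻¹) ⟩
    1ℂ * 1ℂ * (1ℂ * 1ℂ)                         ≈⟨ solve 0 (con 1ℚ :* con 1ℚ :* (con 1ℚ :* con 1ℚ) := con 1ℚ) refl ⟩
    1ℂ                                          ∎

  module _ {N} {g h : ℕ → ℂ} (h₀≈g₀ : h 0 ≈ g 0)
           (step : ∀ i d → suc i ℕ.+ d ≡ N →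
             fromℕ N * h (suc i) ≈ fromℕ d * g (suc i) + fromℕ (suc i) * g i) where

    -- The closed form is multiplied by N to avoid a division. In the induction step (d+1)/(d+1)! =
    -- 1/d!, y = -y′ and 1/i! = (i+1)/(i+1)! turn the previous value into -(i+1) `weight (suc i) d`
    -- g i. This cancels the second summand that `step` provides.
    partial-sum : ∀ i d → i ℕ.+ d ≡ N →
      fromℕ N * ∑ i (λ j → weight j (N ℕ.∸ j) * h j) ≈ fromℕ d * (weight i d * g i)
    partial-sum zero    d ≡.refl = *-congˡ (*-congˡ h₀≈g₀)
    partial-sum (suc i) d eq = begin
      fromℕ N * (∑ i τ + τ (suc i))
        ≈⟨ distribˡ _ _ _ ⟩
      fromℕ N * ∑ i τ + fromℕ N * τ (suc i)
        ≈⟨ +-cong (partial-sum i (suc d) (≡.trans (ℕ.+-suc i d) eq))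
             (*-congˡ (*-congʳ (reflexive (≡.cong (weight (suc i)) N∸1+i≡d)))) ⟩
      fromℕ (suc d) * (y * y ^ d * y′ ^ i * (factorial i ⁻¹ * factorial (suc d) ⁻¹) * g i)
        + fromℕ N * (y ^ d * (y′ * y′ ^ i) * (factorial (suc i) ⁻¹ * factorial d ⁻¹) * h (suc i))
        ≈⟨ solve 12 (λ d₁ y y′ yd y′i fi fd₁ gi n fi₁ fd h →
             d₁ :* (y :* yd :* y′i :* (fi :* fd₁) :* gi) :+ n :* (yd :* (y′ :* y′i) :* (fi₁ :* fd) :* h)
             := y :* (yd :* y′i) :* (fi :* (d₁ :* fd₁)) :* gi :+ (yd :* (y′ :* y′i) :* (fi₁ :* fd)) :* (n :* h))
             refl (fromℕ (suc d)) y y′ (y ^ d) (y′ ^ i) (factorial i ⁻¹) (factorial (suc d) ⁻¹) (g i)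
             (fromℕ N) (factorial (suc i) ⁻¹) (factorial d ⁻¹) (h (suc i)) ⟩
      y * (y ^ d * y′ ^ i) * (factorial i ⁻¹ * (fromℕ (suc d) * factorial (suc d) ⁻¹)) * g i
        + weight (suc i) d * (fromℕ N * h (suc i))
        ≈⟨ +-cong
             (*-congʳ (*-cong (*-congʳ y≈-y′) (*-cong (sym (factorial-suc-⁻¹ i)) (factorial-suc-⁻¹ d))))
             (*-congˡ (step i d eq)) ⟩
      - y′ * (y ^ d * y′ ^ i) * (fromℕ (suc i) * factorial (suc i) ⁻¹ * factorial d ⁻¹) * g i
        + weight (suc i) d * (fromℕ d * g (suc i) + fromℕ (suc i) * g i)
        ≈⟨ solve 9 (λ y′ yd y′i i₁ fi₁ fd gi d gi₁ →
             :- y′ :* (yd :* y′i) :* (i₁ :* fi₁ :* fd) :* gi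
               :+ (yd :* (y′ :* y′i) :* (fi₁ :* fd)) :* (d :* gi₁ :+ i₁ :* gi)
             := d :* (yd :* (y′ :* y′i) :* (fi₁ :* fd) :* gi₁))
             refl y′ (y ^ d) (y′ ^ i) (fromℕ (suc i)) (factorial (suc i) ⁻¹) (factorial d ⁻¹) (g i)
             (fromℕ d) (g (suc i)) ⟩
      fromℕ d * (weight (suc i) d * g (suc i)) ∎
      where
      τ : ℕ → ℂ
      τ j = weight j (N ℕ.∸ j) * h j
      N∸1+i≡d : N ℕ.∸ suc i ≡ d
      N∸1+i≡d = ≡.trans (≡.cong (ℕ._∸ suc i) (≡.sym eq)) (ℕ.m+n∸m≡n (suc i) d)

    sum≈0 : .{{_ : ℕ.NonZero N}} → ∑ N (λ j → weight j (N ℕ.∸ j) * h j) ≈ 0ℂ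
    sum≈0 = *-cancelʳ (fromℕˣ N) (begin
      ∑ N _ * fromℕ N               ≈⟨ *-comm _ _ ⟩
      -- The full sum is the case d = 0, where the closed form carries the factor `fromℕ 0`, which
      -- computes to `0ℂ`.
      fromℕ N * ∑ N _               ≈⟨ partial-sum N 0 (ℕ.+-identityʳ N) ⟩
      0ℂ * (weight N 0 * g N)       ≈⟨ zeroˡ _ ⟩
      0ℂ                            ≈⟨ zeroˡ _ ⟨
      0ℂ * fromℕ N                  ∎)

-- Coefficients of polynomials

coeff-+ₚ : ∀ p q k → coeff (p +ₚ q) k ≈ coeff p k + coeff q k
coeff-+ₚ []      q       k       = sym (+-identityˡ _)
coeff-+ₚ (a ∷ p) []      k       = sym (+-identityʳ _)
coeff-+ₚ (a ∷ p) (b ∷ q) zero    = refl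
coeff-+ₚ (a ∷ p) (b ∷ q) (suc k) = coeff-+ₚ p q k

coeff-·ₚ : ∀ c p k → coeff (c ·ₚ p) k ≈ c * coeff p k
coeff-·ₚ c []      k       = sym (zeroʳ c)
coeff-·ₚ c (a ∷ p) zero    = refl
coeff-·ₚ c (a ∷ p) (suc k) = coeff-·ₚ c p k

coeff-∑ₚ : ∀ n f k → coeff (∑ₚ n f) k ≈ ∑ n (λ i → coeff (f i) k)
coeff-∑ₚ zero    f k = refl
coeff-∑ₚ (suc n) f k = trans (coeff-+ₚ (∑ₚ n f) (f (suc n)) k) (+-congʳ (coeff-∑ₚ n f k))

coeff-∑-·ₚ : ∀ n (c : ℕ → ℂ) (f : ℕ → Poly) k → coeff (∑ₚ n (λ i → c i ·ₚ f i)) k ≈ ∑ n (λ i → c i * coeff (f i) k)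
coeff-∑-·ₚ n c f k = trans (coeff-∑ₚ n _ k) (∑-cong n λ i _ → coeff-·ₚ (c i) (f i) k)

coeff-∷-*ₚ-zero : ∀ a p q → coeff ((a ∷ p) *ₚ q) 0 ≈ a * coeff q 0
coeff-∷-*ₚ-zero a p q = trans (coeff-+ₚ (a ·ₚ q) _ 0) (trans (+-identityʳ _) (coeff-·ₚ a q 0))

coeff-∷-*ₚ-suc : ∀ a p q k → coeff ((a ∷ p) *ₚ q) (suc k) ≈ a * coeff q (suc k) + coeff (p *ₚ q) k
coeff-∷-*ₚ-suc a p q k = trans (coeff-+ₚ (a ·ₚ q) _ (suc k)) (+-congʳ (coeff-·ₚ a q (suc k)))

coeff-constant-*ₚ : ∀ a q k → coeff ((a ∷ []) *ₚ q) k ≈ a * coeff q k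
coeff-constant-*ₚ a q zero    = coeff-∷-*ₚ-zero a [] q
coeff-constant-*ₚ a q (suc k) = trans (coeff-∷-*ₚ-suc a [] q k) (+-identityʳ _)

-- The constant term is only assumed equal to 0, because in `u 1` it is the product `α * 0ℂ`.
module _ {a b : ℂ} (a≈0 : a ≈ 0ℂ) where

  coeff-linear-*ₚ-zero : ∀ q → coeff ((a ∷ b ∷ []) *ₚ q) 0 ≈ 0ℂ
  coeff-linear-*ₚ-zero q = trans (coeff-∷-*ₚ-zero a (b ∷ []) q) (trans (*-congʳ a≈0) (zeroˡ _))

  coeff-linear-*ₚ-suc : ∀ q k → coeff ((a ∷ b ∷ []) *ₚ q) (suc k) ≈ b * coeff q k
  coeff-linear-*ₚ-suc q k = begin
    coeff ((a ∷ b ∷ []) *ₚ q) (suc k)                ≈⟨ coeff-∷-*ₚ-suc a (b ∷ []) q k ⟩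
    a * coeff q (suc k) + coeff ((b ∷ []) *ₚ q) k    ≈⟨ +-cong (*-congʳ a≈0) (coeff-constant-*ₚ b q k) ⟩
    0ℂ * coeff q (suc k) + b * coeff q k             ≈⟨ +-congʳ (zeroˡ _) ⟩
    0ℂ + b * coeff q k                               ≈⟨ +-identityˡ _ ⟩
    b * coeff q k                                    ∎

coeff-X^ : ∀ n k → coeff (X ^ₚ n) k ≈ identity n k
coeff-X^ zero    zero    = refl
coeff-X^ zero    (suc k) = refl
coeff-X^ (suc n) zero    = coeff-linear-*ₚ-zero refl (X ^ₚ n)
coeff-X^ (suc n) (suc k) = begin
  coeff (X ^ₚ suc n) (suc k)     ≈⟨ coeff-linear-*ₚ-suc refl (X ^ₚ n) k ⟩
  1ℂ * coeff (X ^ₚ n) k          ≈⟨ *-identityˡ _ ⟩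
  coeff (X ^ₚ n) k               ≈⟨ coeff-X^ n k ⟩
  identity n k                   ≈⟨ identity-suc ⟩
  identity (suc n) (suc k)       ∎
  where
  identity-suc : identity n k ≈ identity (suc n) (suc k)
  identity-suc with n ℕ.≟ k
  ... | yes ≡.refl = sym (identity-≡ (suc n))
  ... | no n≢k     = sym (identity-≢ λ eq → n≢k (ℕ.suc-injective eq))

-- For k ≤ n the summand j = k is the only one with x^k. For k > n there is none, and triangularity
-- makes the entry 0 as well.
coeff-∑-monomials : ∀ {M} → LowerTriangular M → ∀ n k → coeff (∑ₚ n (λ j → M n j ·ₚ X ^ₚ j)) k ≈ M n k
coeff-∑-monomials {M} lower n k = trans (coeff-∑-·ₚ n (M n) (X ^ₚ_) k) select
  where
  off : ∀ j → j ≢ k → M n j * coeff (X ^ₚ j) k ≈ 0ℂ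
  off j j≢k = trans (*-congˡ (trans (coeff-X^ j k) (identity-≢ j≢k))) (zeroʳ _)
  select : ∑ n (λ j → M n j * coeff (X ^ₚ j) k) ≈ M n k
  select with k ℕ.≤? n
  ... | yes k≤n = trans (∑-single n k k≤n off)
    (trans (*-congˡ (trans (coeff-X^ k k) (identity-≡ k))) (*-identityʳ _))
  ... | no k≰n  = trans
    (∑-zero n λ j j≤n → off j λ { ≡.refl → k≰n j≤n }) (sym (lower n k (ℕ.≰⇒> k≰n)))

-- Entries of the two matrices

-- Each factor is -z - m = -(z + m), so one sign comes out per factor.
falling-neg : ∀ z m → falling (- z) m ≈ (- 1ℂ) ^ m * rising z m
falling-neg z zero    = sym (*-identityˡ _)
falling-neg z (suc m) = trans (*-congʳ (falling-neg z m))
  (solve 4 (λ e r z m → e :* r :* (:- z :- m) := :- con 1ℚ :* e :* (r :* (z :+ m))) refl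
    ((- 1ℂ) ^ m) (rising z m) z (fromℕ m))

-- In its use for the entries of `A`, with r = s + k: D is C^λ, f is r!, R is (λ)_r, e is (-1)^r, ab
-- is α^k β^s, c is C^r, F is the coefficient from u^r, g is k! s! and p is 2^k (-y)^s.
clear-denominators : ∀ {D D′ f f′ R e ab c F g p} →
  D * D′ ≈ 1ℂ → f * f′ ≈ 1ℂ → F * g ≈ f * ab → e * ab * c ≈ p →
  R * p ≈ 1ℂ * D′ * (e * R * f′ * F) * (g * (D * c))
clear-denominators {D} {D′} {f} {f′} {R} {e} {ab} {c} {F} {g} {p} DD′ ff′ Fg eabc = begin
  R * p
    ≈⟨ *-congˡ eabc ⟨
  R * (e * ab * c)
    ≈⟨ trans (*-identityˡ _) (*-identityˡ _) ⟨
  1ℂ * (1ℂ * (R * (e * ab * c)))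
    ≈⟨ *-cong DD′ (*-congʳ ff′) ⟨
  D * D′ * (f * f′ * (R * (e * ab * c)))
    ≈⟨ solve 8 (λ D D′ f f′ R e ab c → D :* D′ :* (f :* f′ :* (R :* (e :* ab :* c)))
         := f :* ab :* (D :* D′ :* f′ :* R :* e :* c)) refl D D′ f f′ R e ab c ⟩
  f * ab * (D * D′ * f′ * R * e * c)
    ≈⟨ *-congʳ Fg ⟨
  F * g * (D * D′ * f′ * R * e * c)
    ≈⟨ solve 8 (λ F g D D′ f′ R e c → F :* g :* (D :* D′ :* f′ :* R :* e :* c)
         := con 1ℚ :* D′ :* (e :* R :* f′ :* F) :* (g :* (D :* c))) refl F g D D′ f′ R e c ⟩
  1ℂ * D′ * (e * R * f′ * F) * (g * (D * c)) ∎

module Entries (lam y C : ℂ) (lam>0 : Positive lam) (C≉0 : C ≉0) (C^lam : Power C lam) where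

  -- Cˣ and C^lam+ are written out below: the copies made by this open unfold
  -- at once, and comparing quotients then compares the proofs of apartness.
  open Gegenbauer lam y C lam>0 C≉0 C^lam hiding (Cˣ; C^lam+)

  -- Coefficients of the powers of u = αxt + βt²

  α β : ℂ
  α = - (fromℕ 2 / (nonzero C C≉0))
  β = y / (nonzero C C≉0)

  c : ℕ → ℕ → ℕ → ℂ
  c m n k = coeff ((u ^ₛ m) n) k

  α*0≈0 : α * 0ℂ ≈ 0ℂ
  α*0≈0 = zeroʳ α

  coeff-u₁-zero : ∀ q → coeff (u 1 *ₚ q) 0 ≈ 0ℂ
  coeff-u₁-zero q = coeff-linear-*ₚ-zero α*0≈0 q

  coeff-u₁-suc : ∀ q k → coeff (u 1 *ₚ q) (suc k) ≈ α * coeff q k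
  coeff-u₁-suc q k = trans (coeff-linear-*ₚ-suc α*0≈0 q k) (*-congʳ (*-identityʳ α))

  coeff-u₂ : ∀ q k → coeff (u 2 *ₚ q) k ≈ β * coeff q k
  coeff-u₂ q k = trans (coeff-constant-*ₚ (β * 1ℂ) q k) (*-congʳ (*-identityʳ β))

  c-suc : ∀ m n k →
    c (suc m) (2 ℕ.+ n) k ≈ coeff (u 1 *ₚ (u ^ₛ m) (suc n)) k + coeff (u 2 *ₚ (u ^ₛ m) n) k
  c-suc m n k = trans (coeff-∑ₚ (2 ℕ.+ n) _ k) (∑-middle n refl (λ _ → refl))

  c-1-zero : ∀ m → c (suc m) 1 0 ≈ 0ℂ
  c-1-zero m = coeff-u₁-zero ((u ^ₛ m) 0)

  c-1-suc : ∀ m k → c (suc m) 1 (suc k) ≈ α * c m 0 k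
  c-1-suc m k = coeff-u₁-suc ((u ^ₛ m) 0) k

  c-2+n-zero : ∀ m n → c (suc m) (2 ℕ.+ n) 0 ≈ β * c m n 0
  c-2+n-zero m n = trans (c-suc m n 0)
    (trans (+-cong (coeff-u₁-zero ((u ^ₛ m) (suc n))) (coeff-u₂ ((u ^ₛ m) n) 0)) (+-identityˡ _))

  c-2+n-suc : ∀ m n k → c (suc m) (2 ℕ.+ n) (suc k) ≈ α * c m (suc n) k + β * c m n (suc k)
  c-2+n-suc m n k = trans (c-suc m n (suc k))
    (+-cong (coeff-u₁-suc ((u ^ₛ m) (suc n)) k) (coeff-u₂ ((u ^ₛ m) n) (suc k)))

  -- A product of k factors αxt and s factors βt² comes from u^(s+k) and has degree 2s + k in t. The
  -- induction splits off one factor u at a time.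
  c-support : ∀ m n k → (∀ s → m ≡ s ℕ.+ k → ¬ Offset s n k) → c m n k ≈ 0ℂ
  c-support zero    zero    zero    none = ⊥-elim (none 0 ≡.refl ≡.refl)
  c-support zero    zero    (suc k) none = refl
  c-support zero    (suc n) k       none = refl
  c-support (suc m) zero    k       none = refl
  c-support (suc m) (suc zero) zero none = c-1-zero m
  c-support (suc m) (suc zero) (suc k) none = trans (c-1-suc m k)
    (trans (*-congˡ (c-support m 0 k λ s e o →
      none s (≡.trans (≡.cong suc e) (≡.sym (ℕ.+-suc s k)))
             (≡.trans (≡.cong suc o) (≡.sym (ℕ.+-suc (s ℕ.* 2) k))))) (zeroʳ α))
  c-support (suc m) (suc (suc n)) zero none = trans (c-2+n-zero m n)
    (trans (*-congˡ (c-support m n 0 λ s e o →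
      none (suc s) (≡.cong suc e) (≡.cong (2 ℕ.+_) o))) (zeroʳ β))
  c-support (suc m) (suc (suc n)) (suc k) none = trans (c-2+n-suc m n k) (trans (+-cong
    (trans (*-congˡ (c-support m (suc n) k λ s e o →
      none s (≡.trans (≡.cong suc e) (≡.sym (ℕ.+-suc s k)))
             (≡.trans (≡.cong suc o) (≡.sym (ℕ.+-suc (s ℕ.* 2) k))))) (zeroʳ α))
    (trans (*-congˡ (c-support m n (suc k) λ s e o →
      none (suc s) (≡.cong suc e) (≡.cong (2 ℕ.+_) o))) (zeroʳ β)))
    (+-identityˡ 0ℂ))

  fac : ℕ → ℂ
  fac n = value (factorial n)

  c-offset : ℕ → ℕ → ℂ
  c-offset s k = c (s ℕ.+ k) (s ℕ.* 2 ℕ.+ k) k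

  c-offset-suc-zero : ∀ s → c-offset (suc s) 0 ≈ β * c-offset s 0
  c-offset-suc-zero s = c-2+n-zero (s ℕ.+ 0) (s ℕ.* 2 ℕ.+ 0)

  c-offset-zero-suc : ∀ k → c-offset 0 (suc k) ≈ α * c-offset 0 k
  c-offset-zero-suc zero    = c-1-suc 0 0
  c-offset-zero-suc (suc k) = trans (c-2+n-suc (suc k) k (suc k)) (trans
    -- The β term is a coefficient of x^(k+2) in u^(k+1), which vanishes since u has degree 1 in x.
    (+-congˡ (trans (*-congˡ (c-support (suc k) k (suc (suc k)) λ s e _ →
      ℕ.<⇒≱ (ℕ.≤-refl {suc (suc k)}) (ℕ.≤-trans (ℕ.m≤n+m _ s) (ℕ.≤-reflexive (≡.sym e))))) (zeroʳ β)))
    (+-identityʳ _))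

  c-offset-suc-suc : ∀ s k →
    c-offset (suc s) (suc k) ≈ α * c-offset (suc s) k + β * c-offset s (suc k)
  c-offset-suc-suc s k = trans (c-2+n-suc (s ℕ.+ suc k) (s ℕ.* 2 ℕ.+ suc k) k)
    (+-congʳ (*-congˡ (reflexive (≡.cong₂ (λ m n → c m n k) (ℕ.+-suc s k)
      (≡.cong suc (ℕ.+-suc (s ℕ.* 2) k))))))

  -- Splitting off one factor u gives Pascal's rule with weights α and β. After multiplication by k!
  -- s! the two branches contribute the factors k and s, whose sum s + k is the new top factor of
  -- the factorial.
  c-offset-value : ∀ s k →
    c (s ℕ.+ k) (s ℕ.* 2 ℕ.+ k) k * (fac k * fac s) ≈ fac (s ℕ.+ k) * (α ^ k * β ^ s)
  c-offset-value zero    zero    = trans (*-identityˡ _) (*-congˡ (trans fromℕ-1 (sym (*-identityˡ _))))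
  c-offset-value (suc s) zero    = begin
    c-offset (suc s) 0 * (fac 0 * fac (suc s))
      ≈⟨ *-cong (c-offset-suc-zero s) (*-congˡ (factorial-suc s)) ⟩
    β * c-offset s 0 * (fac 0 * (fac s * fromℕ (suc s)))
      ≈⟨ solve 5 (λ b F f₀ f s → b :* F :* (f₀ :* (f :* s)) := b :* s :* (F :* (f₀ :* f))) refl
           β (c-offset s 0) (fac 0) (fac s) (fromℕ (suc s)) ⟩
    β * fromℕ (suc s) * (c-offset s 0 * (fac 0 * fac s))
      ≈⟨ *-congˡ (c-offset-value s 0) ⟩
    β * fromℕ (suc s) * (fac (s ℕ.+ 0) * (1ℂ * β ^ s))
      ≈⟨ solve 5 (λ b s f o bs → b :* s :* (f :* (o :* bs)) := f :* s :* (o :* (b :* bs))) refl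
           β (fromℕ (suc s)) (fac (s ℕ.+ 0)) 1ℂ (β ^ s) ⟩
    fac (s ℕ.+ 0) * fromℕ (suc s) * (1ℂ * (β * β ^ s))
      ≈⟨ *-congʳ (trans (*-congˡ (reflexive (≡.cong (λ m → fromℕ (suc m)) (≡.sym (ℕ.+-identityʳ s)))))
           (sym (factorial-suc (s ℕ.+ 0)))) ⟩
    fac (suc s ℕ.+ 0) * (1ℂ * (β * β ^ s)) ∎
  c-offset-value zero    (suc k) = begin
    c-offset 0 (suc k) * (fac (suc k) * fac 0)
      ≈⟨ *-cong (c-offset-zero-suc k) (*-congʳ (factorial-suc k)) ⟩
    α * c-offset 0 k * (fac k * fromℕ (suc k) * fac 0)
      ≈⟨ solve 5 (λ a F f k f₀ → a :* F :* (f :* k :* f₀) := a :* k :* (F :* (f :* f₀))) refl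
           α (c-offset 0 k) (fac k) (fromℕ (suc k)) (fac 0) ⟩
    α * fromℕ (suc k) * (c-offset 0 k * (fac k * fac 0))
      ≈⟨ *-congˡ (c-offset-value 0 k) ⟩
    α * fromℕ (suc k) * (fac k * (α ^ k * 1ℂ))
      ≈⟨ solve 5 (λ a s f ak o → a :* s :* (f :* (ak :* o)) := f :* s :* (a :* ak :* o)) refl
           α (fromℕ (suc k)) (fac k) (α ^ k) 1ℂ ⟩
    fac k * fromℕ (suc k) * (α * α ^ k * 1ℂ)
      ≈⟨ *-congʳ (factorial-suc k) ⟨
    fac (suc k) * (α * α ^ k * 1ℂ) ∎
  c-offset-value (suc s) (suc k) = begin
    c-offset (suc s) (suc k) * (fac (suc k) * fac (suc s))
      ≈⟨ *-cong (c-offset-suc-suc s k) (*-congʳ (factorial-suc k)) ⟩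
    (α * F₁ + β * F₂) * (fac k * fromℕ (suc k) * fac (suc s))
      ≈⟨ solve 7 (λ a F₁ b F₂ f k g → (a :* F₁ :+ b :* F₂) :* (f :* k :* g)
           := a :* k :* (F₁ :* (f :* g)) :+ b :* (F₂ :* (f :* k :* g))) refl
           α F₁ β F₂ (fac k) (fromℕ (suc k)) (fac (suc s)) ⟩
    α * fromℕ (suc k) * (F₁ * (fac k * fac (suc s))) + β * (F₂ * (fac k * fromℕ (suc k) * fac (suc s)))
      ≈⟨ +-congˡ (*-congˡ (*-congˡ (*-cong (sym (factorial-suc k)) (factorial-suc s)))) ⟩
    α * fromℕ (suc k) * (F₁ * (fac k * fac (suc s))) + β * (F₂ * (fac (suc k) * (fac s * fromℕ (suc s))))
      ≈⟨ +-congˡ (solve 5 (λ b F f g s → b :* (F :* (f :* (g :* s))) := b :* s :* (F :* (f :* g))) refl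
           β F₂ (fac (suc k)) (fac s) (fromℕ (suc s))) ⟩
    α * fromℕ (suc k) * (F₁ * (fac k * fac (suc s))) + β * fromℕ (suc s) * (F₂ * (fac (suc k) * fac s))
      ≈⟨ +-cong (*-congˡ (c-offset-value (suc s) k))
           (*-congˡ (trans (c-offset-value s (suc k)) (*-congʳ (reflexive (≡.cong fac (ℕ.+-suc s k)))))) ⟩
    α * fromℕ (suc k) * (f * (α ^ k * (β * β ^ s))) + β * fromℕ (suc s) * (f * (α * α ^ k * β ^ s))
      ≈⟨ solve 7 (λ a k f ak b bs s →
           a :* k :* (f :* (ak :* (b :* bs))) :+ b :* s :* (f :* (a :* ak :* bs))
           := f :* (s :+ k) :* (a :* ak :* (b :* bs))) refl
           α (fromℕ (suc k)) f (α ^ k) β (β ^ s) (fromℕ (suc s)) ⟩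
    f * (fromℕ (suc s) + fromℕ (suc k)) * (α * α ^ k * (β * β ^ s))
      ≈⟨ *-congʳ (trans (*-congˡ (trans (sym (fromℕ-+ (suc s) (suc k)))
           (reflexive (≡.cong (λ m → fromℕ (suc m)) (ℕ.+-suc s k))))) (sym (factorial-suc (suc (s ℕ.+ k))))) ⟩
    fac (suc (suc (s ℕ.+ k))) * (α * α ^ k * (β * β ^ s))
      ≈⟨ *-congʳ (reflexive (≡.cong (λ m → fac (suc m)) (≡.sym (ℕ.+-suc s k)))) ⟩
    fac (suc s ℕ.+ suc k) * (α * α ^ k * (β * β ^ s)) ∎
    where
    F₁ F₂ f : ℂ
    F₁ = c-offset (suc s) k
    F₂ = c-offset s (suc k)
    f = fac (suc s ℕ.+ k)

  -- Each α takes one sign and one C, and each β does too: -αC = 2 and -βC = -y.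
  sign-powers : ∀ s k →
    (- 1ℂ) ^ (s ℕ.+ k) * (α ^ k * β ^ s) * C ^ (s ℕ.+ k) ≈ fromℕ 2 ^ k * (- y) ^ s
  sign-powers s k = begin
    (- 1ℂ) ^ (s ℕ.+ k) * (α ^ k * β ^ s) * C ^ (s ℕ.+ k)
      ≈⟨ *-cong (*-congʳ (^-homo-* (- 1ℂ) s k)) (^-homo-* C s k) ⟩
    (- 1ℂ) ^ s * (- 1ℂ) ^ k * (α ^ k * β ^ s) * (C ^ s * C ^ k)
      ≈⟨ solve 6 (λ es ek ak bs cs ck →
           es :* ek :* (ak :* bs) :* (cs :* ck) := ek :* (ak :* ck) :* (es :* (bs :* cs))) refl
           ((- 1ℂ) ^ s) ((- 1ℂ) ^ k) (α ^ k) (β ^ s) (C ^ s) (C ^ k) ⟩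
    (- 1ℂ) ^ k * (α ^ k * C ^ k) * ((- 1ℂ) ^ s * (β ^ s * C ^ s))
      ≈⟨ *-cong (collect α k) (collect β s) ⟩
    (- 1ℂ * (α * C)) ^ k * (- 1ℂ * (β * C)) ^ s
      ≈⟨ *-cong (^-congˡ k -αC≈2) (^-congˡ s -βC≈-y) ⟩
    fromℕ 2 ^ k * (- y) ^ s ∎
    where
    collect : ∀ z m → (- 1ℂ) ^ m * (z ^ m * C ^ m) ≈ (- 1ℂ * (z * C)) ^ m
    collect z m = sym (trans (^-distrib-* (- 1ℂ) (z * C) m) (*-congˡ (^-distrib-* z C m)))
    -αC≈2 : - 1ℂ * (α * C) ≈ fromℕ 2
    -αC≈2 = trans (solve 2 (λ q c → :- con 1ℚ :* (:- q :* c) := q :* c) refl (fromℕ 2 / (nonzero C C≉0)) C)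
      (/-cancel (fromℕ 2) (nonzero C C≉0))
    -βC≈-y : - 1ℂ * (β * C) ≈ - y
    -βC≈-y = trans (solve 1 (λ q → :- con 1ℚ :* q := :- q) refl (β * C)) (-‿cong (/-cancel y (nonzero C C≉0)))

  -- Closed forms of the entries

  A-sum : ∀ n k → A n k ≈ 1ℂ / powerˣ C^lam * ∑ n (λ m → binomial (- lam) m * c m n k)
  A-sum n k = trans (coeff-·ₚ _ (([1+ u ]^ (- lam)) n) k)
    (*-congˡ (coeff-∑-·ₚ n (binomial (- lam)) (λ m → (u ^ₛ m) n) k))

  A-support : EvenSupport A
  A-support n k none = trans (A-sum n k) (trans
    (*-congˡ (∑-zero n λ m _ → trans (*-congˡ (c-support m n k λ s _ → none s)) (zeroʳ _)))
    (zeroʳ _))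

  D D⁻¹ C⁻¹ : ℂ
  D = value (powerˣ C^lam)
  D⁻¹ = powerˣ C^lam ⁻¹
  C⁻¹ = (nonzero C C≉0) ⁻¹

  R fac⁻¹ : ℕ → ℂ
  R = rising lam
  fac⁻¹ n = factorial n ⁻¹

  -- Opaque outside this block: only the two equations ending in `-def` lead back to the
  -- reciprocals, so comparisons of terms do not unfold the proofs of apartness inside.
  abstract
    R⁻¹ half^ : ℕ → ℂ
    R⁻¹ r = risingˣ lam>0 r ⁻¹
    half^ n = (fromℕˣ 2 ^ˣ n) ⁻¹

    R⁻¹-def : ∀ r → risingˣ lam>0 r ⁻¹ ≈ R⁻¹ r
    R⁻¹-def r = refl

    half^-def : ∀ n → (fromℕˣ 2 ^ˣ n) ⁻¹ ≈ half^ n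
    half^-def n = refl

  C^lam+-value : ∀ r → value (Gegenbauer.C^lam+ lam y C lam>0 C≉0 C^lam r) ≈ D * C ^ r
  C^lam+-value r = *-congˡ (value-^ˣ (nonzero C C≉0) r)

  C^lam+-⁻¹ : ∀ r → (Gegenbauer.C^lam+ lam y C lam>0 C≉0 C^lam r) ⁻¹ ≈ D⁻¹ * C⁻¹ ^ r
  C^lam+-⁻¹ r = ⁻¹-*-^ (Gegenbauer.C^lam+ lam y C lam>0 C≉0 C^lam r) (powerˣ C^lam)
    (nonzero C C≉0) r (C^lam+-value r)

  a-numerator : ℕ → ℕ → ℂ
  a-numerator s k = R (s ℕ.+ k) * fromℕ 2 ^ k * (- y) ^ s

  a-quotient : ∀ s k {n} → Offset s n k →
    a n k ≈ a-numerator s k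
      / (factorial k *ˣ factorial s *ˣ Gegenbauer.C^lam+ lam y C lam>0 C≉0 C^lam (s ℕ.+ k))
  a-quotient s k o = reflexive (ifEven-offset _ s k o)

  b-numerator : ℕ → ℕ → ℕ → ℂ
  b-numerator n s k = fac n * (lam + fromℕ k) * y ^ s
    * value (Gegenbauer.C^lam+ lam y C lam>0 C≉0 C^lam (s ℕ.+ k))

  b-quotient : ∀ s k {n} → Offset s n k →
    b n k ≈ b-numerator n s k / (fromℕˣ 2 ^ˣ n *ˣ factorial s *ˣ risingˣ lam>0 (suc (s ℕ.+ k)))
  b-quotient s k o = reflexive (ifEven-offset _ s k o)

  -- The index r is tied to s + k by an equation because in the matrix products it arrives in the
  -- form N + r.
  a-offset : ∀ s k {n r} → Offset s n k → s ℕ.+ k ≡ r →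
    a n k ≈ R r * fromℕ 2 ^ k * (- y) ^ s * (fac⁻¹ k * fac⁻¹ s * (D⁻¹ * C⁻¹ ^ r))
  a-offset s k o ≡.refl = trans (a-quotient s k o) (trans
    (/-*ˣ (a-numerator s k) (factorial k) (factorial s)
      (Gegenbauer.C^lam+ lam y C lam>0 C≉0 C^lam (s ℕ.+ k)))
    (*-congˡ (*-congˡ (C^lam+-⁻¹ (s ℕ.+ k)))))

  b-offset : ∀ s k {n r} → Offset s n k → s ℕ.+ k ≡ r →
    b n k ≈ fac n * (lam + fromℕ k) * y ^ s * (D * C ^ r) * (half^ n * fac⁻¹ s * R⁻¹ (suc r))
  b-offset s k {n} o ≡.refl = trans (b-quotient s k o) (trans
    (/-*ˣ (b-numerator n s k) (fromℕˣ 2 ^ˣ n) (factorial s) (risingˣ lam>0 (suc (s ℕ.+ k))))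
    (*-cong (*-congˡ (C^lam+-value (s ℕ.+ k))) (*-cong (*-congʳ (half^-def n)) (R⁻¹-def (suc (s ℕ.+ k))))))

  -- Only the power of u with exponent s + k survives, since n = 2t + k determines t. The surviving
  -- term is compared with the quotient after multiplication by the denominator of the latter.
  A-offset : ∀ s k {n} → Offset s n k → A n k ≈ a n k
  A-offset s k {n} ≡.refl = begin
    A n k
      ≈⟨ A-sum n k ⟩
    1ℂ / powerˣ C^lam * ∑ n (λ m → binomial (- lam) m * c m n k)
      ≈⟨ *-congˡ (∑-single n r (ℕ.+-monoˡ-≤ k (ℕ.m≤m*n s 2)) off) ⟩
    1ℂ / powerˣ C^lam * (binomial (- lam) r * c r n k)
      ≈⟨ *-congˡ (*-congʳ (*-congʳ (falling-neg lam r))) ⟩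
    1ℂ / powerˣ C^lam * ((- 1ℂ) ^ r * R r / factorial r * c r n k)
      ≈⟨ /-unique
           (factorial k *ˣ factorial s *ˣ Gegenbauer.C^lam+ lam y C lam>0 C≉0 C^lam (s ℕ.+ k)) cleared ⟨
    a-numerator s k
      / (factorial k *ˣ factorial s *ˣ Gegenbauer.C^lam+ lam y C lam>0 C≉0 C^lam (s ℕ.+ k))
      ≈⟨ a-quotient s k ≡.refl ⟨
    a n k ∎
    where
    r : ℕ
    r = s ℕ.+ k
    off : ∀ m → m ≢ r → binomial (- lam) m * c m n k ≈ 0ℂ
    off m m≢r = trans (*-congˡ (c-support m n k λ t m≡t+k o → m≢r (≡.trans m≡t+k
      (≡.cong (ℕ._+ k) (ℕ.*-cancelʳ-≡ t s 2 (ℕ.+-cancelʳ-≡ k _ _ (≡.sym o))))))) (zeroʳ _)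
    cleared : a-numerator s k ≈
      1ℂ / powerˣ C^lam * ((- 1ℂ) ^ r * R r / factorial r * c r n k)
        * (fac k * fac s * value (Gegenbauer.C^lam+ lam y C lam>0 C≉0 C^lam (s ℕ.+ k)))
    cleared = trans (*-assoc _ _ _) (trans
      (clear-denominators (⁻¹-inverse (powerˣ C^lam)) (⁻¹-inverse (factorial r))
        (c-offset-value s k) (sign-powers s k))
      (*-congˡ (*-congˡ (sym (C^lam+-value r)))))

  a-support : EvenSupport a
  a-support = ifEven-support _

  b-support : EvenSupport b
  b-support = ifEven-support _

  A≈a : ∀ n k → A n k ≈ a n k
  A≈a n k = [ (λ { (s , o) → A-offset s k {n} o })
            , (λ none → trans (A-support n k none) (sym (a-support n k none))) ]′ (offset? n k)

  -- Index and inversion identities for the two products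

  offset-difference : ∀ i d k → Offset d ((i ℕ.+ d) ℕ.* 2 ℕ.+ k) (i ℕ.* 2 ℕ.+ k)
  offset-difference = solveℕ 3 (λ i d k →
    (i :+ℕ d) :*ℕ conℕ 2 :+ℕ k :=ℕ d :*ℕ conℕ 2 :+ℕ (i :*ℕ conℕ 2 :+ℕ k)) ≡.refl

  -- Half the sum of the row 2(i+d) + k and the column 2i + k, split as N + r with N = i + d and r =
  -- i + k. Then C^(N+r) factors as C^N C^r, and C^r cancels against the other matrix.
  mean-index : ∀ i d k → d ℕ.+ (i ℕ.* 2 ℕ.+ k) ≡ (i ℕ.+ d) ℕ.+ (i ℕ.+ k)
  mean-index = solveℕ 3 (λ i d k →
    d :+ℕ (i :*ℕ conℕ 2 :+ℕ k) :=ℕ (i :+ℕ d) :+ℕ (i :+ℕ k)) ≡.refl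

  C-inverse : ∀ n → C ^ n * C⁻¹ ^ n ≈ 1ℂ
  C-inverse n = ^-inverse n (⁻¹-inverse (nonzero C C≉0))

  half-inverse : ∀ n → fromℕ 2 ^ n * half^ n ≈ 1ℂ
  half-inverse n = trans
    (*-cong (sym (value-^ˣ (fromℕˣ 2) n)) (sym (half^-def n))) (⁻¹-inverse (fromℕˣ 2 ^ˣ n))

  R⁻¹-suc : ∀ r → R⁻¹ r ≈ (lam + fromℕ r) * R⁻¹ (suc r)
  R⁻¹-suc r = begin
    R⁻¹ r                                          ≈⟨ R⁻¹-def r ⟨
    risingˣ lam>0 r ⁻¹                             ≈⟨ ⁻¹-absorb (risingˣ lam>0 r) (risingˣ lam>0 (suc r)) refl ⟨
    (lam + fromℕ r) * risingˣ lam>0 (suc r) ⁻¹     ≈⟨ *-congˡ (R⁻¹-def (suc r)) ⟩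
    (lam + fromℕ r) * R⁻¹ (suc r)                  ∎

  R⁻¹-inverse : ∀ r → R r * R⁻¹ r ≈ 1ℂ
  R⁻¹-inverse r = trans (*-congˡ (sym (R⁻¹-def r))) (⁻¹-inverse (risingˣ lam>0 r))

  fromℕ-double+ : ∀ i k → fromℕ (i ℕ.* 2 ℕ.+ k) ≈ fromℕ i + fromℕ (i ℕ.+ k)
  fromℕ-double+ i k = trans (reflexive (≡.cong fromℕ (solveℕ 2 (λ i k →
    i :*ℕ conℕ 2 :+ℕ k :=ℕ i :+ℕ (i :+ℕ k)) ≡.refl i k))) (fromℕ-+ i (i ℕ.+ k))

  -- The product of `b` and `a`

  module BA (k : ℕ) where

    open Telescope y (- y) (solve 1 (λ y → y := :- (:- y)) refl y)

    h : ℕ → ℕ → ℕ → ℂ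
    h N j r = (lam + fromℕ j) * R r * R⁻¹ (suc (N ℕ.+ r))

    g : ℕ → ℕ → ℂ
    g N i = R (suc (i ℕ.+ k)) * R⁻¹ (suc (N ℕ.+ (i ℕ.+ k)))

    scale : ℕ → ℕ → ℂ
    scale N n = fac n * C ^ N * half^ n * fromℕ 2 ^ k * fac⁻¹ k

    -- C^λ and C^r cancel between the two entries. Apart from `weight` and `h`, what is left depends
    -- on the row and on k but not on the summation index.
    term : ∀ {n j r} N i d → Offset d n j → Offset i j k → d ℕ.+ j ≡ N ℕ.+ r → i ℕ.+ k ≡ r →
      b n j * a j k ≈ scale N n * (weight i d * h N j r)
    term {n} {j} {r} N i d n-j j-k n+j j+k = begin
      b n j * a j k
        ≈⟨ *-cong (b-offset d j n-j n+j) (a-offset i k j-k j+k) ⟩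
      fac n * (lam + fromℕ j) * y ^ d * (D * C ^ (N ℕ.+ r)) * (half^ n * fac⁻¹ d * R⁻¹ (suc (N ℕ.+ r)))
        * (R r * fromℕ 2 ^ k * (- y) ^ i * (fac⁻¹ k * fac⁻¹ i * (D⁻¹ * C⁻¹ ^ r)))
        ≈⟨ *-congʳ (*-congʳ (*-congˡ (*-congˡ (^-homo-* C N r)))) ⟩
      fac n * (lam + fromℕ j) * y ^ d * (D * (C ^ N * C ^ r)) * (half^ n * fac⁻¹ d * R⁻¹ (suc (N ℕ.+ r)))
        * (R r * fromℕ 2 ^ k * (- y) ^ i * (fac⁻¹ k * fac⁻¹ i * (D⁻¹ * C⁻¹ ^ r)))
        ≈⟨ solve 16 (λ fn l yd D CN Cr t fd Rv Rr 2k y′i fk fi D′ Cr′ →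
             fn :* l :* yd :* (D :* (CN :* Cr)) :* (t :* fd :* Rv)
               :* (Rr :* 2k :* y′i :* (fk :* fi :* (D′ :* Cr′)))
             := D :* D′ :* (Cr :* Cr′)
               :* (fn :* CN :* t :* 2k :* fk :* (yd :* y′i :* (fi :* fd) :* (l :* Rr :* Rv)))) refl
             (fac n) (lam + fromℕ j) (y ^ d) D (C ^ N) (C ^ r) (half^ n) (fac⁻¹ d) (R⁻¹ (suc (N ℕ.+ r)))
             (R r) (fromℕ 2 ^ k) ((- y) ^ i) (fac⁻¹ k) (fac⁻¹ i) D⁻¹ (C⁻¹ ^ r) ⟩
      D * D⁻¹ * (C ^ r * C⁻¹ ^ r) * (scale N n * (weight i d * h N j r))
        ≈⟨ *-congʳ (*-cong (⁻¹-inverse (powerˣ C^lam)) (C-inverse r)) ⟩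
      1ℂ * 1ℂ * (scale N n * (weight i d * h N j r))
        ≈⟨ trans (*-congʳ (*-identityˡ 1ℂ)) (*-identityˡ _) ⟩
      scale N n * (weight i d * h N j r) ∎

    -- Put e = i + 1 and r = e + k. Over the common denominator (λ)_(N+r+1) and up to the factor
    -- (λ)_r, the claim with N = e + d is (e + d)(λ + e + r) = d(λ + r) + e(λ + N + r).
    step : ∀ {N} i d → suc i ℕ.+ d ≡ N →
      fromℕ N * h N (suc i ℕ.* 2 ℕ.+ k) (suc i ℕ.+ k) ≈ fromℕ d * g N (suc i) + fromℕ (suc i) * g N i
    step {N} i d ≡.refl = begin
      fromℕ N * ((lam + fromℕ (suc i ℕ.* 2 ℕ.+ k)) * ρ * v)
        ≈⟨ *-cong (fromℕ-+ (suc i) d) (*-congʳ (*-congʳ (+-congˡ (fromℕ-double+ (suc i) k)))) ⟩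
      (fromℕ (suc i) + fromℕ d) * ((lam + (fromℕ (suc i) + fromℕ r)) * ρ * v)
        ≈⟨ solve 6 (λ i d l r ρ v → (i :+ d) :* ((l :+ (i :+ r)) :* ρ :* v)
             := d :* (ρ :* (l :+ r) :* v) :+ i :* (ρ :* ((l :+ (i :+ d :+ r)) :* v))) refl
             (fromℕ (suc i)) (fromℕ d) lam (fromℕ r) ρ v ⟩
      fromℕ d * (ρ * (lam + fromℕ r) * v)
        + fromℕ (suc i) * (ρ * ((lam + (fromℕ (suc i) + fromℕ d + fromℕ r)) * v))
        ≈⟨ +-congˡ (*-congˡ (*-congˡ (trans (R⁻¹-suc (N ℕ.+ r))
             (*-congʳ (+-congˡ (trans (fromℕ-+ N r) (+-congʳ (fromℕ-+ (suc i) d)))))))) ⟨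
      fromℕ d * g N (suc i) + fromℕ (suc i) * (ρ * R⁻¹ (N ℕ.+ r))
        ≈⟨ +-congˡ (*-congˡ (*-congˡ (reflexive (≡.cong R⁻¹ (ℕ.+-suc N (i ℕ.+ k)))))) ⟩
      fromℕ d * g N (suc i) + fromℕ (suc i) * g N i ∎
      where
      r : ℕ
      r = suc i ℕ.+ k
      ρ v : ℂ
      ρ = R r
      v = R⁻¹ (suc (N ℕ.+ r))

    off-diagonal : ∀ N → .{{_ : ℕ.NonZero N}} →
      ∑ N (λ i → b (N ℕ.* 2 ℕ.+ k) (i ℕ.* 2 ℕ.+ k) * a (i ℕ.* 2 ℕ.+ k) k) ≈ 0ℂ
    off-diagonal N = begin
      ∑ N (λ i → b (N ℕ.* 2 ℕ.+ k) (i ℕ.* 2 ℕ.+ k) * a (i ℕ.* 2 ℕ.+ k) k)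
        ≈⟨ ∑-cong N (λ i i≤N → term-sum i (N ℕ.∸ i) (ℕ.m+[n∸m]≡n i≤N)) ⟩
      ∑ N (λ i → scale N (N ℕ.* 2 ℕ.+ k) * (weight i (N ℕ.∸ i) * h N (i ℕ.* 2 ℕ.+ k) (i ℕ.+ k)))
        ≈⟨ ∑-distribˡ N (scale N (N ℕ.* 2 ℕ.+ k)) ⟩
      scale N (N ℕ.* 2 ℕ.+ k) * ∑ N (λ i → weight i (N ℕ.∸ i) * h N (i ℕ.* 2 ℕ.+ k) (i ℕ.+ k))
        -- At i = 0 the two functions agree because (λ)_(k+1) unfolds to (λ)_k (λ + k), the same two
        -- factors swapped.
        ≈⟨ *-congˡ (sum≈0 {g = g N} (*-congʳ (*-comm _ _)) step) ⟩
      scale N (N ℕ.* 2 ℕ.+ k) * 0ℂ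
        ≈⟨ zeroʳ _ ⟩
      0ℂ ∎
      where
      term-sum : ∀ i d → i ℕ.+ d ≡ N →
        b (N ℕ.* 2 ℕ.+ k) (i ℕ.* 2 ℕ.+ k) * a (i ℕ.* 2 ℕ.+ k) k
          ≈ scale N (N ℕ.* 2 ℕ.+ k) * (weight i d * h N (i ℕ.* 2 ℕ.+ k) (i ℕ.+ k))
      term-sum i d ≡.refl = term N i d (offset-difference i d k) ≡.refl (mean-index i d k) ≡.refl

    diagonal : b k k * a k k ≈ 1ℂ
    diagonal = begin
      b k k * a k k
        ≈⟨ term 0 0 0 ≡.refl ≡.refl ≡.refl ≡.refl ⟩
      fac k * 1ℂ * half^ k * fromℕ 2 ^ k * fac⁻¹ k * (weight 0 0 * ((lam + fromℕ k) * R k * R⁻¹ (suc k)))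
        ≈⟨ *-congˡ (*-congʳ weight-0-0) ⟩
      fac k * 1ℂ * half^ k * fromℕ 2 ^ k * fac⁻¹ k * (1ℂ * ((lam + fromℕ k) * R k * R⁻¹ (suc k)))
        ≈⟨ solve 7 (λ f t 2k f′ l R v → f :* con 1ℚ :* t :* 2k :* f′ :* (con 1ℚ :* (l :* R :* v))
             := f :* f′ :* (2k :* t) :* (R :* l :* v)) refl
             (fac k) (half^ k) (fromℕ 2 ^ k) (fac⁻¹ k) (lam + fromℕ k) (R k) (R⁻¹ (suc k)) ⟩
      fac k * fac⁻¹ k * (fromℕ 2 ^ k * half^ k) * (R (suc k) * R⁻¹ (suc k))
        ≈⟨ *-cong (*-cong (⁻¹-inverse (factorial k)) (half-inverse k)) (R⁻¹-inverse (suc k)) ⟩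
      1ℂ * 1ℂ * 1ℂ
        ≈⟨ trans (*-identityʳ _) (*-identityʳ _) ⟩
      1ℂ ∎

  -- The product of `a` and `b`

  module AB (k : ℕ) where

    open Telescope (- y) y refl

    -- This is 1/(λ + N + k), written so that the only reciprocals are those of rising factorials.
    q⁻¹ : ℕ → ℂ
    q⁻¹ N = R (N ℕ.+ k) * R⁻¹ (suc (N ℕ.+ k))

    q-inverse : ∀ N → (lam + fromℕ (N ℕ.+ k)) * q⁻¹ N ≈ 1ℂ
    q-inverse N = trans
      (solve 3 (λ q R v → q :* (R :* v) := R :* q :* v) refl
        (lam + fromℕ (N ℕ.+ k)) (R (N ℕ.+ k)) (R⁻¹ (suc (N ℕ.+ k))))
      (R⁻¹-inverse (suc (N ℕ.+ k)))

    h g : ℕ → ℕ → ℂ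
    h N r = R (N ℕ.+ r) * R⁻¹ (suc r)
    g N i = R (suc (N ℕ.+ (i ℕ.+ k))) * R⁻¹ (suc (i ℕ.+ k)) * q⁻¹ N

    scale : ℕ → ℂ
    scale N = (lam + fromℕ k) * C⁻¹ ^ N

    -- Besides the powers of C, the factors j! and 2^j of the summation index j cancel between the
    -- two entries.
    term : ∀ {n j r} N i d → Offset d n j → Offset i j k → d ℕ.+ j ≡ N ℕ.+ r → i ℕ.+ k ≡ r →
      a n j * b j k ≈ scale N * (weight i d * h N r)
    term {n} {j} {r} N i d n-j j-k n+j j+k = begin
      a n j * b j k
        ≈⟨ *-cong (a-offset d j n-j n+j) (b-offset i k j-k j+k) ⟩
      R (N ℕ.+ r) * fromℕ 2 ^ j * (- y) ^ d * (fac⁻¹ j * fac⁻¹ d * (D⁻¹ * C⁻¹ ^ (N ℕ.+ r)))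
        * (fac j * (lam + fromℕ k) * y ^ i * (D * C ^ r) * (half^ j * fac⁻¹ i * R⁻¹ (suc r)))
        ≈⟨ *-congʳ (*-congˡ (*-congˡ (*-congˡ (^-homo-* C⁻¹ N r)))) ⟩
      R (N ℕ.+ r) * fromℕ 2 ^ j * (- y) ^ d * (fac⁻¹ j * fac⁻¹ d * (D⁻¹ * (C⁻¹ ^ N * C⁻¹ ^ r)))
        * (fac j * (lam + fromℕ k) * y ^ i * (D * C ^ r) * (half^ j * fac⁻¹ i * R⁻¹ (suc r)))
        ≈⟨ solve 16 (λ RN 2j y′d fj fd D′ CN′ Cr′ fj′ l yi D Cr t fi Rv →
             RN :* 2j :* y′d :* (fj :* fd :* (D′ :* (CN′ :* Cr′)))
               :* (fj′ :* l :* yi :* (D :* Cr) :* (t :* fi :* Rv))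
             := fj′ :* fj :* (2j :* t) :* (D :* D′ :* (Cr :* Cr′))
               :* (l :* CN′ :* (y′d :* yi :* (fi :* fd) :* (RN :* Rv)))) refl
             (R (N ℕ.+ r)) (fromℕ 2 ^ j) ((- y) ^ d) (fac⁻¹ j) (fac⁻¹ d) D⁻¹ (C⁻¹ ^ N) (C⁻¹ ^ r)
             (fac j) (lam + fromℕ k) (y ^ i) D (C ^ r) (half^ j) (fac⁻¹ i) (R⁻¹ (suc r)) ⟩
      fac j * fac⁻¹ j * (fromℕ 2 ^ j * half^ j) * (D * D⁻¹ * (C ^ r * C⁻¹ ^ r))
        * (scale N * (weight i d * h N r))
        ≈⟨ *-congʳ (*-cong (*-cong (⁻¹-inverse (factorial j)) (half-inverse j))
             (*-cong (⁻¹-inverse (powerˣ C^lam)) (C-inverse r))) ⟩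
      1ℂ * 1ℂ * (1ℂ * 1ℂ) * (scale N * (weight i d * h N r))
        ≈⟨ solve 1 (λ z → con 1ℚ :* con 1ℚ :* (con 1ℚ :* con 1ℚ) :* z := z) refl _ ⟩
      scale N * (weight i d * h N r) ∎

    h₀≈g₀ : ∀ N → h N k ≈ g N 0
    h₀≈g₀ N = begin
      R (N ℕ.+ k) * R⁻¹ (suc k)
        ≈⟨ trans (*-congˡ (q-inverse N)) (*-identityʳ _) ⟨
      R (N ℕ.+ k) * R⁻¹ (suc k) * ((lam + fromℕ (N ℕ.+ k)) * q⁻¹ N)
        ≈⟨ solve 4 (λ R v q q′ → R :* v :* (q :* q′) := R :* q :* v :* q′) refl
             (R (N ℕ.+ k)) (R⁻¹ (suc k)) (lam + fromℕ (N ℕ.+ k)) (q⁻¹ N) ⟩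
      g N 0 ∎

    -- Put e = i + 1 and r = e + k. Up to the factor (λ)_(N+r) / ((λ)_(r+1) (λ + N + k)), the claim
    -- with N = e + d is N(λ + N + k) = d(λ + N + r) + e(λ + r).
    step : ∀ {N} i d → suc i ℕ.+ d ≡ N →
      fromℕ N * h N (suc i ℕ.+ k) ≈ fromℕ d * g N (suc i) + fromℕ (suc i) * g N i
    step {N} i d ≡.refl = begin
      fromℕ N * (ρ * v)
        ≈⟨ trans (*-congˡ (q-inverse N)) (*-identityʳ _) ⟨
      fromℕ N * (ρ * v) * ((lam + fromℕ (N ℕ.+ k)) * q)
        ≈⟨ *-cong (*-congʳ (fromℕ-+ (suc i) d)) (*-congʳ (+-congˡ
             (trans (fromℕ-+ N k) (+-congʳ (fromℕ-+ (suc i) d))))) ⟩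
      (fromℕ (suc i) + fromℕ d) * (ρ * v) * ((lam + (fromℕ (suc i) + fromℕ d + fromℕ k)) * q)
        ≈⟨ solve 7 (λ i d k l ρ v q →
             (i :+ d) :* (ρ :* v) :* ((l :+ (i :+ d :+ k)) :* q)
             := d :* (ρ :* (l :+ (i :+ d :+ (i :+ k))) :* v :* q) :+ i :* (ρ :* ((l :+ (i :+ k)) :* v) :* q))
             refl (fromℕ (suc i)) (fromℕ d) (fromℕ k) lam ρ v q ⟩
      fromℕ d * (ρ * (lam + (fromℕ (suc i) + fromℕ d + (fromℕ (suc i) + fromℕ k))) * v * q)
        + fromℕ (suc i) * (ρ * ((lam + (fromℕ (suc i) + fromℕ k)) * v) * q)
        ≈⟨ +-cong
             (*-congˡ (*-congʳ (*-congʳ (*-congˡ (+-congˡ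
               (trans (fromℕ-+ N r) (+-cong (fromℕ-+ (suc i) d) (fromℕ-+ (suc i) k))))))))
             (*-congˡ (*-congʳ (*-congˡ (trans (R⁻¹-suc r) (*-congʳ (+-congˡ (fromℕ-+ (suc i) k))))))) ⟨
      fromℕ d * g N (suc i) + fromℕ (suc i) * (ρ * R⁻¹ r * q)
        ≈⟨ +-congˡ (*-congˡ (*-congʳ (*-congʳ (reflexive (≡.cong R (ℕ.+-suc N (i ℕ.+ k))))))) ⟩
      fromℕ d * g N (suc i) + fromℕ (suc i) * g N i ∎
      where
      r : ℕ
      r = suc i ℕ.+ k
      ρ v q : ℂ
      ρ = R (N ℕ.+ r)
      v = R⁻¹ (suc r)
      q = q⁻¹ N

    off-diagonal : ∀ N → .{{_ : ℕ.NonZero N}} →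
      ∑ N (λ i → a (N ℕ.* 2 ℕ.+ k) (i ℕ.* 2 ℕ.+ k) * b (i ℕ.* 2 ℕ.+ k) k) ≈ 0ℂ
    off-diagonal N = begin
      ∑ N (λ i → a (N ℕ.* 2 ℕ.+ k) (i ℕ.* 2 ℕ.+ k) * b (i ℕ.* 2 ℕ.+ k) k)
        ≈⟨ ∑-cong N (λ i i≤N → term-sum i (N ℕ.∸ i) (ℕ.m+[n∸m]≡n i≤N)) ⟩
      ∑ N (λ i → scale N * (weight i (N ℕ.∸ i) * h N (i ℕ.+ k)))
        ≈⟨ ∑-distribˡ N (scale N) ⟩
      scale N * ∑ N (λ i → weight i (N ℕ.∸ i) * h N (i ℕ.+ k))
        ≈⟨ *-congˡ (sum≈0 {g = g N} (h₀≈g₀ N) step) ⟩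
      scale N * 0ℂ
        ≈⟨ zeroʳ _ ⟩
      0ℂ ∎
      where
      term-sum : ∀ i d → i ℕ.+ d ≡ N →
        a (N ℕ.* 2 ℕ.+ k) (i ℕ.* 2 ℕ.+ k) * b (i ℕ.* 2 ℕ.+ k) k ≈ scale N * (weight i d * h N (i ℕ.+ k))
      term-sum i d ≡.refl = term N i d (offset-difference i d k) ≡.refl (mean-index i d k) ≡.refl

    diagonal : a k k * b k k ≈ 1ℂ
    diagonal = trans (*-comm _ _) (BA.diagonal k)

  -- Inversion and the expansion of x^n

  b⊗A≈identity : ∀ n k → (b ⊗ A) n k ≈ identity n k
  b⊗A≈identity n k = trans (⊗-cong {b} {b} {A} {a} (λ _ _ → refl) A≈a n k)
    (⊗≈identity b-support a-support BA.diagonal (λ N k → BA.off-diagonal k N) n k)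

  A⊗b≈identity : ∀ n k → (A ⊗ b) n k ≈ identity n k
  A⊗b≈identity n k = trans (⊗-cong {A} {a} {b} {b} A≈a (λ _ _ → refl) n k)
    (⊗≈identity a-support b-support AB.diagonal (λ N k → AB.off-diagonal k N) n k)

  inverse : Inverse A b
  inverse = record
    { lower-A  = evenSupport-lower A-support
    ; lower-B  = evenSupport-lower b-support
    ; inverseʳ = A⊗b≈identity
    ; inverseˡ = b⊗A≈identity
    }

corollary4p5 : (lam y C : ℂ) (lam>0 : Positive lam) (C≉0 : C ≉0) (C^lam : Power C lam) →
    let open Gegenbauer lam y C lam>0 C≉0 C^lam in
    (∀ n → P n ≈ₚ ∑ₚ n (λ k → A n k ·ₚ X ^ₚ k))
    × (∀ n k → A n k ≈ a n k)
    × Inverse A b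
    × (∀ n → X ^ₚ n ≈ₚ ∑ₚ n (λ k → b n k ·ₚ P k))
corollary4p5 lam y C lam>0 C≉0 C^lam =
    (λ n → mk≈ₚ λ k → sym (coeff-∑-monomials (evenSupport-lower E.A-support) n k))
  , E.A≈a
  , E.inverse
  -- Row j of `A` holds the coefficients of `P j`, so the expansion of x^n is the left inverse
  -- property read off coefficient by coefficient.
  , (λ n → mk≈ₚ λ k → begin
      coeff (X ^ₚ n) k                           ≈⟨ coeff-X^ n k ⟩
      identity n k                               ≈⟨ E.b⊗A≈identity n k ⟨
      (G.b ⊗ G.A) n k                            ≈⟨ coeff-∑-·ₚ n (G.b n) G.P k ⟨
      coeff (∑ₚ n (λ j → G.b n j ·ₚ G.P j)) k    ∎)
  where
  module G = Gegenbauer lam y C lam>0 C≉0 C^lam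
  module E = Entries lam y C lam>0 C≉0 C^lam
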